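{- For every positive integer $h$ there exists a constant $c(h)$ depending only on $h$ such that the following holds. Let $P$ be a poset of height $h$, let $k$ be a positive integer and let $d=2|P|$. If a family $\mathcal{F}\subset[k]^d$ does not contain an induced copy of $P$, then $$|\mathcal{F}|\le |P|^{c(h)}k^{d-1}.$$
   Context: $[k]^d$ denotes the set of vectors with entries in $\{1,\dots,k\}$, ordered coordinatewise. The height of a poset is the size of its largest chain. An induced copy of $P$ in a poset $Q$ is a subset $P'\subset Q$ with a bijection $\pi:P\to P'$ such that $x\le_P y$ iff $\pi(x)\le_Q\pi(y)$. -}

module Defs where

open import Data.Nat using (ℕ; _≤_)
open import Data.Fin using (Fin)
import Data.Fin as F
open import Data.Vec using (Vec)
open import Data.Vec.Relation.Binary.Pointwise.Inductive using (Pointwise)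
open import Data.List using (List; length)
open import Data.List.Relation.Unary.Unique.Propositional using (Unique)
open import Data.List.Relation.Unary.AllPairs using (AllPairs)
open import Data.List.Membership.Propositional using (_∈_)
open import Data.Product using (Σ; _×_; ∃)
open import Data.Sum using (_⊎_)
open import Function.Bundles using (_⇔_)
open import Function.Definitions using (Injective)
open import Relation.Binary.PropositionalEquality using (_≡_)
open import Relation.Binary.Structures using (IsPartialOrder)

record FinPoset (n : ℕ) : Set₁ where
  field
    _≤P_ : Fin n → Fin n → Set
    isPartialOrder : IsPartialOrder _≡_ _≤P_
open FinPoset public

Comparable : ∀ {n} → FinPoset n → Fin n → Fin n → Set
Comparable P x y = _≤P_ P x y ⊎ _≤P_ P y x

IsChain : ∀ {n} → FinPoset n → List (Fin n) → Set
IsChain P xs = Unique xs × AllPairs (Comparable P) xs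

HasHeight : ∀ {n} → FinPoset n → ℕ → Set
HasHeight P h =
  (Σ (List _) λ xs → IsChain P xs × length xs ≡ h)
  × (∀ xs → IsChain P xs → length xs ≤ h)

Grid : ℕ → ℕ → Set
Grid k d = Vec (Fin k) d

_≤G_ : ∀ {k d} → Grid k d → Grid k d → Set
_≤G_ = Pointwise F._≤_

InducedCopy : ∀ {n k d} → FinPoset n → List (Grid k d) → Set
InducedCopy {n} {k} {d} P F =
  Σ (Fin n → Grid k d) λ π →
    (∀ x → π x ∈ F)
    × Injective _≡_ _≡_ π
    × (∀ x y → (_≤P_ P x y ⇔ (π x ≤G π y)))

{-# OPTIONS --safe #-}
-- Split coordinates into S-ary digits (S = b ^ r a constant) and induct on k by contracting each S-cube
-- of the grid to a point; only copies that are strict in every coordinate are sought, so that they lift.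
-- For a cube, the number of points of F in it is at most the number of vectors T of d types that F
-- shatters there (a Sauer–Shelah inequality): T singles out, on each of its strong coordinates,
-- 2h zones in increasing order, and shattering means that all zone patterns occur in F.  The T with fewer than
-- n = |P| strong coordinates are too few to matter, at most S ^ (d − 1) / 2, which makes the recursion
-- contract.  For any other T, if more than h d k ^ (d − 1) cubes shatter T, then h of those cubes
-- agree on n strong coordinates and increase strictly on the rest.  Put the elements of level i of P in
-- the i-th cube and give each q ∈ P its own strong coordinate, on which p goes to the zone of its level,
-- raised by h zones when q ≤ p.  This is an induced copy of P.
module Submission where

open import Defs
open import Data.Bool using (Bool; true; false; not)
open import Data.Empty using (⊥-elim)
open import Data.Fin as Fin using (Fin; zero; suc; toℕ; fromℕ<)
import Data.Fin.Properties as Fin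
open import Data.List using (List; []; _∷_; _++_; length; map; concatMap; replicate; upTo; applyUpTo; allFin; tabulate; cartesianProductWith)
open import Data.List.Membership.Propositional using (_∈_)
open import Data.List.Membership.Propositional.Properties using (∈-map⁻)
import Data.List.Membership.DecPropositional as DecMembership
open import Data.List.Properties using (map-∘; length-map; length-tabulate; length-applyUpTo)
open import Data.List.Relation.Unary.All as All using (All; []; _∷_)
open import Data.List.Relation.Unary.AllPairs as AllPairs using (AllPairs; []; _∷_)
open import Data.List.Relation.Unary.Any using (here; there)
open import Data.List.Relation.Unary.Unique.Propositional using (Unique)
open import Data.List.Relation.Unary.Unique.Propositional.Properties using (map⁺)
open import Data.Maybe as Maybe using (Maybe; just; nothing)
open import Data.Nat using (ℕ; NonZero; >-nonZero; >-nonZero⁻¹; zero; suc; _+_; _*_; _∸_; _^_; _≤_; _<_; z≤n; s≤s)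
open import Data.Nat.DivMod using (_/_; _%_; m/n<m; m/n*n≤m; m%n<n; m≡m%n+[m/n]*n)
open import Data.Nat.ListAction using (sum)
open import Data.Nat.Properties
open import Data.Nat.Tactic.RingSolver using (solve-∀)
open import Data.Product using (Σ; ∃; _×_; _,_; proj₁; proj₂)
open import Data.Sum using (inj₁; inj₂)
open import Data.Unit using (⊤; tt)
open import Data.Vec as Vec using (Vec; []; _∷_; lookup)
import Data.Vec.Properties as Vec
open import Data.Vec.Relation.Binary.Pointwise.Inductive as Pointwise using ([]; _∷_)
open import Data.Vec.Relation.Unary.All as VecAll using ([]; _∷_)
open import Function using (_∘_; id; mk⇔)
open import Level using (0ℓ)
open import Relation.Binary.Definitions using (tri<; tri≈; tri>)
open import Relation.Binary.PropositionalEquality using (_≡_; _≢_; refl; sym; trans; cong; cong₂; subst; subst₂; module ≡-Reasoning)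
open import Relation.Binary.Structures using (IsPartialOrder)
open import Relation.Nullary using (¬_; Dec; yes; no; does)
open import Relation.Nullary.Decidable using (map′; _×-dec_; _→-dec_; ¬?; decidable-stable; ¬¬-excluded-middle)
open import Relation.Unary using (Pred; Decidable)

-- Finite sums

private variable
  A B : Set
  P Q : Set

𝟙 : Dec P → ℕ
𝟙 (yes _) = 1
𝟙 (no _)  = 0

𝟙≤1 : (p : Dec P) → 𝟙 p ≤ 1
𝟙≤1 (yes _) = ≤-refl
𝟙≤1 (no _)  = z≤n

𝟙-mono : (P → Q) → (p : Dec P) (q : Dec Q) → 𝟙 p ≤ 𝟙 q
𝟙-mono f (yes p) (yes q) = ≤-refl
𝟙-mono f (yes p) (no ¬q) = ⊥-elim (¬q (f p))
𝟙-mono f (no _)  q       = z≤n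

𝟙-yes : P → (p : Dec P) → 𝟙 p ≡ 1
𝟙-yes x (yes _) = refl
𝟙-yes x (no ¬x) = ⊥-elim (¬x x)

∑ : List A → (A → ℕ) → ℕ
∑ xs f = sum (map f xs)

∑-mono : ∀ (xs : List A) {f g} → (∀ x → f x ≤ g x) → ∑ xs f ≤ ∑ xs g
∑-mono []       f≤g = z≤n
∑-mono (x ∷ xs) f≤g = +-mono-≤ (f≤g x) (∑-mono xs f≤g)

∑-cong : ∀ (xs : List A) {f g} → (∀ x → f x ≡ g x) → ∑ xs f ≡ ∑ xs g
∑-cong []       f≡g = refl
∑-cong (x ∷ xs) f≡g = cong₂ _+_ (f≡g x) (∑-cong xs f≡g)

∑-+ : ∀ (xs : List A) f g → ∑ xs (λ x → f x + g x) ≡ ∑ xs f + ∑ xs g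
∑-+ []       f g = refl
∑-+ (x ∷ xs) f g rewrite ∑-+ xs f g = lemma (f x) (g x) (∑ xs f) (∑ xs g)
  where
  lemma : ∀ a b c d → a + b + (c + d) ≡ a + c + (b + d)
  lemma = solve-∀

∑-*ˡ : ∀ c (xs : List A) f → ∑ xs (λ x → c * f x) ≡ c * ∑ xs f
∑-*ˡ c []       f = sym (*-zeroʳ c)
∑-*ˡ c (x ∷ xs) f rewrite ∑-*ˡ c xs f = sym (*-distribˡ-+ c (f x) (∑ xs f))

∑-*ʳ : ∀ c (xs : List A) f → ∑ xs (λ x → f x * c) ≡ ∑ xs f * c
∑-*ʳ c []       f = refl
∑-*ʳ c (x ∷ xs) f rewrite ∑-*ʳ c xs f = sym (*-distribʳ-+ c (f x) (∑ xs f))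

∑-const : ∀ (xs : List A) c → ∑ xs (λ _ → c) ≡ length xs * c
∑-const []       c = refl
∑-const (x ∷ xs) c = cong (c +_) (∑-const xs c)

∑-≤const : ∀ (xs : List A) {f c} → (∀ x → f x ≤ c) → ∑ xs f ≤ length xs * c
∑-≤const xs {f} {c} f≤c = ≤-trans (∑-mono xs f≤c) (≤-reflexive (∑-const xs c))

∑-swap : ∀ (xs : List A) (ys : List B) (f : A → B → ℕ) →
  ∑ xs (λ x → ∑ ys (f x)) ≡ ∑ ys (λ y → ∑ xs (λ x → f x y))
∑-swap []       ys f = sym (trans (∑-const ys 0) (*-zeroʳ (length ys)))
∑-swap (x ∷ xs) ys f = trans (cong (∑ ys (f x) +_) (∑-swap xs ys f))
                             (sym (∑-+ ys (f x) (λ y → ∑ xs (λ x → f x y))))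

∑-++ : ∀ (xs ys : List A) f → ∑ (xs ++ ys) f ≡ ∑ xs f + ∑ ys f
∑-++ []       ys f = refl
∑-++ (x ∷ xs) ys f = trans (cong (f x +_) (∑-++ xs ys f)) (sym (+-assoc (f x) _ _))

∑-map : ∀ (h : A → B) xs f → ∑ (map h xs) f ≡ ∑ xs (f ∘ h)
∑-map h xs f = cong sum (sym (map-∘ xs))

∑-replicate : ∀ m (x : A) f → ∑ (replicate m x) f ≡ m * f x
∑-replicate zero    x f = refl
∑-replicate (suc m) x f = cong (f x +_) (∑-replicate m x f)

∑-concatMap : ∀ (h : A → List B) xs f → ∑ (concatMap h xs) f ≡ ∑ xs (λ x → ∑ (h x) f)
∑-concatMap h []       f = refl
∑-concatMap h (x ∷ xs) f = trans (∑-++ (h x) (concatMap h xs) f) (cong (∑ (h x) f +_) (∑-concatMap h xs f))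

∑-tabulate : ∀ {n} (h : Fin n → A) f → ∑ (tabulate h) f ≡ ∑ (allFin n) (f ∘ h)
∑-tabulate {n = zero}  h f = refl
∑-tabulate {n = suc n} h f =
  cong (f (h zero) +_) (trans (∑-tabulate (h ∘ suc) f) (sym (∑-tabulate suc (f ∘ h))))

∑-allFin-suc : ∀ n (f : Fin (suc n) → ℕ) → ∑ (allFin (suc n)) f ≡ f zero + ∑ (allFin n) (f ∘ suc)
∑-allFin-suc n f = cong (f zero +_) (∑-tabulate suc f)

∑-applyUpTo : ∀ (h : ℕ → A) n f → ∑ (applyUpTo h n) f ≡ ∑ (upTo n) (f ∘ h)
∑-applyUpTo h zero    f = refl
∑-applyUpTo h (suc n) f =
  cong (f (h 0) +_) (trans (∑-applyUpTo (h ∘ suc) n f) (sym (∑-applyUpTo suc n (f ∘ h))))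

∑-upTo-suc : ∀ n f → ∑ (upTo (suc n)) f ≡ f 0 + ∑ (upTo n) (f ∘ suc)
∑-upTo-suc n f = cong (f 0 +_) (∑-applyUpTo suc n f)

∑-allFin : ∀ n (f : ℕ → ℕ) → ∑ (allFin n) (f ∘ toℕ) ≡ ∑ (upTo n) f
∑-allFin zero    f = refl
∑-allFin (suc n) f = trans (∑-allFin-suc n (f ∘ toℕ))
  (trans (cong (f 0 +_) (∑-allFin n (f ∘ suc))) (sym (∑-upTo-suc n f)))

∑-upTo-+ : ∀ m n f → ∑ (upTo (m + n)) f ≡ ∑ (upTo m) f + ∑ (upTo n) (λ i → f (m + i))
∑-upTo-+ zero    n f = refl
∑-upTo-+ (suc m) n f = begin
  ∑ (upTo (suc m + n)) f                                                   ≡⟨ ∑-upTo-suc (m + n) f ⟩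
  f 0 + ∑ (upTo (m + n)) (f ∘ suc)                                         ≡⟨ cong (f 0 +_) (∑-upTo-+ m n (f ∘ suc)) ⟩
  f 0 + (∑ (upTo m) (f ∘ suc) + ∑ (upTo n) (λ i → f (suc m + i)))          ≡⟨ +-assoc (f 0) _ _ ⟨
  f 0 + ∑ (upTo m) (f ∘ suc) + ∑ (upTo n) (λ i → f (suc m + i))            ≡⟨ cong (_+ ∑ (upTo n) (λ i → f (suc m + i))) (∑-upTo-suc m f) ⟨
  ∑ (upTo (suc m)) f + ∑ (upTo n) (λ i → f (suc m + i))                    ∎
  where open ≡-Reasoning

∑-upTo-* : ∀ m n f → ∑ (upTo (m * n)) f ≡ ∑ (upTo m) (λ i → ∑ (upTo n) (λ j → f (i * n + j)))
∑-upTo-* zero    n f = refl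
∑-upTo-* (suc m) n f = begin
  ∑ (upTo (n + m * n)) f
    ≡⟨ ∑-upTo-+ n (m * n) f ⟩
  ∑ (upTo n) f + ∑ (upTo (m * n)) (λ i → f (n + i))
    ≡⟨ cong (∑ (upTo n) f +_) (∑-upTo-* m n (λ i → f (n + i))) ⟩
  ∑ (upTo n) f + ∑ (upTo m) (λ i → ∑ (upTo n) (λ j → f (n + (i * n + j))))
    ≡⟨ cong (∑ (upTo n) f +_) (∑-cong (upTo m) λ i → ∑-cong (upTo n) λ j → cong f (sym (+-assoc n (i * n) j))) ⟩
  ∑ (upTo n) f + ∑ (upTo m) (λ i → ∑ (upTo n) (λ j → f (suc i * n + j)))
    ≡⟨ ∑-upTo-suc m (λ i → ∑ (upTo n) (λ j → f (i * n + j))) ⟨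
  ∑ (upTo (suc m)) (λ i → ∑ (upTo n) (λ j → f (i * n + j))) ∎
  where open ≡-Reasoning

-- Sums over products of lists

pi : ∀ {d} → Vec (List A) d → List (Vec A d)
pi []         = [] ∷ []
pi (xs ∷ xss) = cartesianProductWith _∷_ xs (pi xss)

∑-pi : ∀ {d} (xs : List A) (xss : Vec (List A) d) f →
  ∑ (pi (xs ∷ xss)) f ≡ ∑ xs (λ x → ∑ (pi xss) (λ v → f (x ∷ v)))
∑-pi []       xss f = refl
∑-pi (x ∷ xs) xss f = trans (∑-++ (map (x ∷_) (pi xss)) _ f)
  (cong₂ _+_ (∑-map (x ∷_) (pi xss) f) (∑-pi xs xss f))

_⋆_ : List A → (d : ℕ) → List (Vec A d)
xs ⋆ d = pi (Vec.replicate d xs)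

∑-⋆-* : ∀ (xs : List A) d (f : A → ℕ) →
  ∑ (xs ⋆ d) (λ v → Vec.foldr _ (λ x p → f x * p) 1 v) ≡ ∑ xs f ^ d
∑-⋆-* xs zero    f = refl
∑-⋆-* xs (suc d) f = begin
  ∑ (xs ⋆ suc d) (λ v → Vec.foldr _ (λ x p → f x * p) 1 v)
    ≡⟨ ∑-pi xs (Vec.replicate d xs) _ ⟩
  ∑ xs (λ x → ∑ (xs ⋆ d) (λ v → f x * Vec.foldr _ (λ x p → f x * p) 1 v))
    ≡⟨ ∑-cong xs (λ x → ∑-*ˡ (f x) (xs ⋆ d) _) ⟩
  ∑ xs (λ x → f x * ∑ (xs ⋆ d) (λ v → Vec.foldr _ (λ x p → f x * p) 1 v))
    ≡⟨ ∑-cong xs (λ x → cong (f x *_) (∑-⋆-* xs d f)) ⟩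
  ∑ xs (λ x → f x * ∑ xs f ^ d)
    ≡⟨ ∑-*ʳ (∑ xs f ^ d) xs f ⟩
  ∑ xs f * ∑ xs f ^ d ∎
  where open ≡-Reasoning

length-∑ : ∀ (xs : List A) → length xs ≡ ∑ xs (λ _ → 1)
length-∑ xs = sym (trans (∑-const xs 1) (*-identityʳ _))

length-⋆ : ∀ (xs : List A) d → length (xs ⋆ d) ≡ length xs ^ d
length-⋆ xs zero    = refl
length-⋆ xs (suc d) = begin
  length (xs ⋆ suc d)                        ≡⟨ length-∑ (xs ⋆ suc d) ⟩
  ∑ (xs ⋆ suc d) (λ _ → 1)                   ≡⟨ ∑-pi xs (Vec.replicate d xs) _ ⟩
  ∑ xs (λ _ → ∑ (xs ⋆ d) (λ _ → 1))          ≡⟨ ∑-const xs _ ⟩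
  length xs * ∑ (xs ⋆ d) (λ _ → 1)           ≡⟨ cong (length xs *_) (sym (length-∑ (xs ⋆ d))) ⟩
  length xs * length (xs ⋆ d)                ≡⟨ cong (length xs *_) (length-⋆ xs d) ⟩
  length xs * length xs ^ d                  ∎
  where open ≡-Reasoning

-- Digits, types and zones

Increasing : ∀ {g b} → Vec (Fin b) g → Set
Increasing e = ∀ i j → i Fin.< j → lookup e i Fin.< lookup e j

increasing? : ∀ {g b} → Decidable (Increasing {g} {b})
increasing? e = Fin.all? λ i → Fin.all? λ j → (i Fin.<? j) →-dec (lookup e i Fin.<? lookup e j)

Hits : ∀ {g b} → Pred (Fin b) 0ℓ → Vec (Fin b) g → Set
Hits Y e = Increasing e × (∀ i → Y (lookup e i))

hits? : ∀ {g b} {Y : Pred (Fin b) 0ℓ} → Decidable Y → Decidable (Hits {g} Y)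
hits? Y? e = increasing? e ×-dec Fin.all? λ i → Y? (lookup e i)

#Fin : ∀ {b} {Y : Pred (Fin b) 0ℓ} → Decidable Y → ℕ
#Fin {b} Y? = ∑ (allFin b) (𝟙 ∘ Y?)

#Fin≤ : ∀ {b} {Y : Pred (Fin b) 0ℓ} (Y? : Decidable Y) → #Fin Y? ≤ b
#Fin≤ {b} Y? = ≤-trans (∑-≤const (allFin b) (𝟙≤1 ∘ Y?))
  (≤-reflexive (trans (*-identityʳ _) (length-tabulate id)))

#Fin-all : ∀ {b} {Y : Pred (Fin b) 0ℓ} (Y? : Decidable Y) → b ≤ #Fin Y? → ∀ i → Y i
#Fin-all {suc b} Y? b≤# i rewrite ∑-allFin-suc b (𝟙 ∘ Y?) with Y? zero | i
... | no _  | _     = ⊥-elim (<-irrefl refl (≤-trans b≤# (#Fin≤ (Y? ∘ suc))))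
... | yes y | zero  = y
... | yes y | suc j = #Fin-all (Y? ∘ suc) (≤-pred b≤#) j

hits-suc : ∀ {g b} {Y : Pred (Fin (suc b)) 0ℓ} {e : Vec (Fin b) g} →
  Hits (Y ∘ suc) e → Hits Y (Vec.map suc e)
hits-suc {Y = Y} {e} (inc , hit) = inc′ , λ i → subst Y (sym (Vec.lookup-map i Fin.suc e)) (hit i)
  where
  inc′ : Increasing (Vec.map suc e)
  inc′ i j i<j rewrite Vec.lookup-map i Fin.suc e | Vec.lookup-map j Fin.suc e = s≤s (inc i j i<j)

hits-cons : ∀ {g b} {Y : Pred (Fin (suc b)) 0ℓ} {e : Vec (Fin b) g} →
  Y zero → Hits (Y ∘ suc) e → Hits Y (zero ∷ Vec.map suc e)
hits-cons {g} {Y = Y} {e} y h = inc′ , hit′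
  where
  inc′ : Increasing (zero ∷ Vec.map suc e)
  inc′ zero    (suc j) _         rewrite Vec.lookup-map j Fin.suc e = s≤s z≤n
  inc′ (suc i) (suc j) (s≤s i<j) = proj₁ (hits-suc {Y = Y} {e} h) i j i<j

  hit′ : ∀ i → Y (lookup (zero ∷ Vec.map suc e) i)
  hit′ zero    = y
  hit′ (suc i) = proj₂ (hits-suc {Y = Y} {e} h) i

-- Scanning upwards and keeping each member of `Y` until `g` are found makes the selection
-- increasing.
#Fin-select : ∀ g {b} {Y : Pred (Fin b) 0ℓ} (Y? : Decidable Y) → g ≤ #Fin Y? → ∃ (Hits {g} Y)
#Fin-select zero    Y? _ = [] , (λ ()) , λ ()
#Fin-select (suc g) {zero} Y? ()
#Fin-select (suc g) {suc b} {Y} Y? g≤# rewrite ∑-allFin-suc b (𝟙 ∘ Y?) with Y? zero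
... | no _ = let e , h = #Fin-select (suc g) (Y? ∘ suc) g≤# in Vec.map suc e , hits-suc {Y = Y} {e} h
... | yes y = let e , h = #Fin-select g (Y? ∘ suc) (≤-pred g≤#) in
  zero ∷ Vec.map suc e , hits-cons {Y = Y} {e} y h

Word : ℕ → ℕ → Set
Word b r = Vec (Fin b) r

words : ∀ b r → List (Word b r)
words b r = allFin b ⋆ r

∃word? : ∀ {b} r {X : Pred (Word b r) 0ℓ} → Decidable X → Dec (∃ X)
∃word? zero    X? = map′ (λ x → [] , x) (λ { ([] , x) → x }) (X? [])
∃word? (suc r) X? = map′ (λ { (c , w , x) → c ∷ w , x }) (λ { (c ∷ w , x) → c , w , x })
  (Fin.any? λ c → ∃word? r (X? ∘ (c ∷_)))

val : ∀ {b r} → Word b r → ℕ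
val []                    = 0
val {b} {suc r} (c ∷ w) = toℕ c * b ^ r + val w

val-cons-< : ∀ {b r} {c c′ : Fin b} (w w′ : Word b r) → val w < b ^ r → c Fin.< c′ → val (c ∷ w) < val (c′ ∷ w′)
val-cons-< {b} {r} {c} {c′} w w′ w< c<c′ = begin-strict
  toℕ c * b ^ r + val w    <⟨ +-monoʳ-< (toℕ c * b ^ r) w< ⟩
  toℕ c * b ^ r + b ^ r    ≡⟨ +-comm (toℕ c * b ^ r) (b ^ r) ⟩
  suc (toℕ c) * b ^ r      ≤⟨ *-monoˡ-≤ (b ^ r) c<c′ ⟩
  toℕ c′ * b ^ r           ≤⟨ m≤m+n _ (val w′) ⟩
  toℕ c′ * b ^ r + val w′  ∎
  where open ≤-Reasoning

val-< : ∀ {b r} (w : Word b r) → val w < b ^ r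
val-< []                    = s≤s z≤n
val-< {b} {suc r} (c ∷ w) = begin-strict
  toℕ c * b ^ r + val w    <⟨ +-monoʳ-< (toℕ c * b ^ r) (val-< w) ⟩
  toℕ c * b ^ r + b ^ r    ≡⟨ +-comm (toℕ c * b ^ r) (b ^ r) ⟩
  suc (toℕ c) * b ^ r      ≤⟨ *-monoˡ-≤ (b ^ r) (Fin.toℕ<n c) ⟩
  b * b ^ r                ∎
  where open ≤-Reasoning

-- Base `b` expansion, leading digit first: `val` runs through the numbers below `b ^ r` exactly
-- once.
∑-words : ∀ b r f → ∑ (words b r) (f ∘ val) ≡ ∑ (upTo (b ^ r)) f
∑-words b zero    f = refl
∑-words b (suc r) f = begin
  ∑ (words b (suc r)) (f ∘ val)
    ≡⟨ ∑-pi (allFin b) (Vec.replicate r (allFin b)) (f ∘ val) ⟩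
  ∑ (allFin b) (λ c → ∑ (words b r) (λ w → f (toℕ c * b ^ r + val w)))
    ≡⟨ ∑-cong (allFin b) (λ c → ∑-words b r (λ j → f (toℕ c * b ^ r + j))) ⟩
  ∑ (allFin b) (λ c → ∑ (upTo (b ^ r)) (λ j → f (toℕ c * b ^ r + j)))
    ≡⟨ ∑-allFin b (λ i → ∑ (upTo (b ^ r)) (λ j → f (i * b ^ r + j))) ⟩
  ∑ (upTo b) (λ i → ∑ (upTo (b ^ r)) (λ j → f (i * b ^ r + j)))
    ≡⟨ ∑-upTo-* b (b ^ r) f ⟨
  ∑ (upTo (b * b ^ r)) f ∎
  where open ≡-Reasoning

-- `E` holds the candidate tuples of children and `μ` scales their multiplicity. Two choices occur
-- later: `b = g`, the tuple of all digits and `μ = 1`; or `b = g ^ 4`, every tuple of `g` digits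
-- and `μ = b`.
module Types (g⁻ b μ : ℕ) (E : List (Vec (Fin b) (suc g⁻))) where

  g : ℕ
  g = suc g⁻

  -- A strong type is a node of the b-ary tree of digits together with g of its children, the zones.
  -- The lists below count types with multiplicity: the weak type g⁻ ^ r times and each here e so often
  -- that a set of words never has more elements than realised types.
  data Strong : ℕ → Set where
    here  : ∀ {r} → Vec (Fin b) g → Strong (suc r)
    there : ∀ {r} → Fin b → Strong r → Strong (suc r)

  Type : ℕ → Set
  Type r = Maybe (Strong r)

  strongs : ∀ r → List (Strong r)
  strongs zero    = []
  strongs (suc r) = concatMap (λ c → map (there c) (strongs r)) (allFin b)
                 ++ concatMap (λ e → replicate (μ * g⁻ ^ r) (here e)) E

  types : ∀ r → List (Type r)
  types r = replicate (g⁻ ^ r) nothing ++ map just (strongs r)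

  RealisesStrong : ∀ {r} → Pred (Word b r) 0ℓ → Strong r → Set
  RealisesStrong X (here e)    = Hits (λ c → ∃ λ w → X (c ∷ w)) e
  RealisesStrong X (there c s) = RealisesStrong (λ w → X (c ∷ w)) s

  Realises : ∀ {r} → Pred (Word b r) 0ℓ → Type r → Set
  Realises X nothing  = ∃ X
  Realises X (just s) = RealisesStrong X s

  realisesStrong? : ∀ {r} {X : Pred (Word b r) 0ℓ} → Decidable X → Decidable (RealisesStrong X)
  realisesStrong? {suc r} X? (here e)    = hits? (λ c → ∃word? r (X? ∘ (c ∷_))) e
  realisesStrong? X? (there c s) = realisesStrong? (X? ∘ (c ∷_)) s

  realises? : ∀ {r} {X : Pred (Word b r) 0ℓ} → Decidable X → Decidable (Realises X)
  realises? X? nothing  = ∃word? _ X?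
  realises? X? (just s) = realisesStrong? X? s

  -- The words that serve as the i-th value of a coordinate of the given type.
  Zone : ∀ {r} → Type r → Fin g → Word b r → Set
  Zone nothing            i w       = ⊤
  Zone (just (here e))    i (c ∷ w) = c ≡ lookup e i
  Zone (just (there c s)) i (d ∷ w) = d ≡ c × Zone (just s) i w

  Ordered : ∀ {r} → Strong r → Set
  Ordered (here e)    = Increasing e
  Ordered (there c s) = Ordered s

  -- `E` may contain tuples that do not increase; these are never realised, because `Hits` includes
  -- `Increasing`.
  realisesStrong⇒ordered : ∀ {r} {X : Pred (Word b r) 0ℓ} s → RealisesStrong X s → Ordered s
  realisesStrong⇒ordered (here e)    = proj₁
  realisesStrong⇒ordered (there c s) = realisesStrong⇒ordered s

  -- Above the branching node the digits agree; at the node the digit of the later zone is larger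
  -- and outweighs all digits after it.
  zone-< : ∀ {r} (s : Strong r) → Ordered s → ∀ {i j} → i Fin.< j →
    ∀ {v w} → Zone (just s) i v → Zone (just s) j w → val v < val w
  zone-< (here e) inc {i} {j} i<j {c ∷ v} {d ∷ w} refl refl = val-cons-< v w (val-< v) (inc i j i<j)
  zone-< {suc r} (there c s) o i<j {_ ∷ v} {_ ∷ w} (refl , zv) (refl , zw) =
    +-monoʳ-< (toℕ c * b ^ r) (zone-< s o i<j zv zw)

  realisesStrong⇒zone : ∀ {r} {X : Pred (Word b r) 0ℓ} s → RealisesStrong X s →
    ∀ i → ∃ λ w → X w × Zone (just s) i w
  realisesStrong⇒zone (here e) (_ , hit) i = let w , x = hit i in lookup e i ∷ w , x , refl
  realisesStrong⇒zone (there c s) R i = let w , x , z = realisesStrong⇒zone s R i in c ∷ w , x , refl , z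

  realises⇒zone : ∀ {r} {X : Pred (Word b r) 0ℓ} t → Realises X t → ∀ i → ∃ λ w → X w × Zone t i w
  realises⇒zone nothing  (w , x) i = w , x , tt
  realises⇒zone (just s) R       i = realisesStrong⇒zone s R i

  ∑-strongs : ∀ r f → ∑ (strongs (suc r)) f ≡
    ∑ (allFin b) (λ c → ∑ (strongs r) (f ∘ there c)) + μ * g⁻ ^ r * ∑ E (f ∘ here)
  ∑-strongs r f = begin
    ∑ (strongs (suc r)) f
      ≡⟨ ∑-++ (concatMap (λ c → map (there c) (strongs r)) (allFin b)) _ f ⟩
    ∑ (concatMap (λ c → map (there c) (strongs r)) (allFin b)) f
      + ∑ (concatMap (λ e → replicate (μ * g⁻ ^ r) (here e)) E) f
      ≡⟨ cong₂ _+_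
           (trans (∑-concatMap (λ c → map (there c) (strongs r)) (allFin b) f)
                  (∑-cong (allFin b) λ c → ∑-map (there c) (strongs r) f))
           (trans (∑-concatMap (λ e → replicate (μ * g⁻ ^ r) (here e)) E f)
             (trans (∑-cong E λ e → ∑-replicate (μ * g⁻ ^ r) (here e) f)
                    (∑-*ˡ (μ * g⁻ ^ r) E (f ∘ here)))) ⟩
    ∑ (allFin b) (λ c → ∑ (strongs r) (f ∘ there c)) + μ * g⁻ ^ r * ∑ E (f ∘ here) ∎
    where open ≡-Reasoning

  ∑-types : ∀ r f → ∑ (types r) f ≡ g⁻ ^ r * f nothing + ∑ (strongs r) (f ∘ just)
  ∑-types r f = trans (∑-++ (replicate (g⁻ ^ r) nothing) _ f)
    (cong₂ _+_ (∑-replicate (g⁻ ^ r) nothing f) (∑-map just (strongs r) f))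

  length-strongs : ∀ r → length (strongs (suc r)) ≡ b * length (strongs r) + μ * g⁻ ^ r * length E
  length-strongs r = begin
    length (strongs (suc r))
      ≡⟨ trans (length-∑ (strongs (suc r))) (∑-strongs r (λ _ → 1)) ⟩
    ∑ (allFin b) (λ _ → ∑ (strongs r) (λ _ → 1)) + μ * g⁻ ^ r * ∑ E (λ _ → 1)
      ≡⟨ cong₂ (λ x y → x + μ * g⁻ ^ r * y)
           (trans (∑-const (allFin b) _) (cong₂ _*_ (length-tabulate {n = b} id) (sym (length-∑ (strongs r)))))
           (sym (length-∑ E)) ⟩
    b * length (strongs r) + μ * g⁻ ^ r * length E ∎
    where open ≡-Reasoning

  M : ℕ
  M = length E * μ

  -- The summand `M * g⁻ ^ r` lets the induction close: types branching at the root contribute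
  -- `M * g⁻ ^ r`, which together with `M * g⁻ ^ suc r` makes `g * (M * g⁻ ^ r)`, and `g ≤ b`.
  length-strongs-≤ : g ≤ b → ∀ r → length (strongs r) + M * g⁻ ^ r ≤ M * b ^ r
  length-strongs-≤ g≤b zero    = ≤-refl
  length-strongs-≤ g≤b (suc r) = begin
    length (strongs (suc r)) + M * (g⁻ * g⁻ ^ r)
      ≡⟨ cong (_+ M * (g⁻ * g⁻ ^ r)) (length-strongs r) ⟩
    b * length (strongs r) + μ * g⁻ ^ r * length E + M * (g⁻ * g⁻ ^ r)
      ≡⟨ lemma (length E) μ g⁻ (g⁻ ^ r) (b * length (strongs r)) ⟩
    b * length (strongs r) + g * (M * g⁻ ^ r)
      ≤⟨ +-monoʳ-≤ (b * length (strongs r)) (*-monoˡ-≤ (M * g⁻ ^ r) g≤b) ⟩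
    b * length (strongs r) + b * (M * g⁻ ^ r)
      ≡⟨ *-distribˡ-+ b (length (strongs r)) (M * g⁻ ^ r) ⟨
    b * (length (strongs r) + M * g⁻ ^ r)
      ≤⟨ *-monoʳ-≤ b (length-strongs-≤ g≤b r) ⟩
    b * (M * b ^ r)
      ≡⟨ lemma₂ b M (b ^ r) ⟩
    M * (b * b ^ r) ∎
    where
    open ≤-Reasoning
    lemma : ∀ l m a p s → s + m * p * l + l * m * (a * p) ≡ s + suc a * (l * m * p)
    lemma = solve-∀
    lemma₂ : ∀ x y z → x * (y * z) ≡ y * (x * z)
    lemma₂ = solve-∀

  module _ (b≤g⁻+μ : b ≤ g⁻ + μ)
           (hit : ∀ {Y : Pred (Fin b) 0ℓ} (Y? : Decidable Y) → g ≤ #Fin Y? → 1 ≤ ∑ E (𝟙 ∘ hits? Y?)) where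

    -- The case of a single digit. At most `g⁻` digits are paid by the weak type; a larger set has
    -- at most `g⁻ + μ` digits and hits an entry of `E`, which counts `μ` times.
    #Fin-≤ : ∀ {Y : Pred (Fin b) 0ℓ} (Y? : Decidable Y) (∃? : Dec (∃ Y)) →
      #Fin Y? ≤ g⁻ * 𝟙 ∃? + μ * ∑ E (𝟙 ∘ hits? Y?)
    #Fin-≤ Y? (no ¬∃) = begin
      #Fin Y?                           ≤⟨ ∑-mono (allFin b) (λ c → 𝟙-mono (λ y → ¬∃ (c , y)) (Y? c) (no id)) ⟩
      ∑ (allFin b) (λ _ → 0)            ≡⟨ trans (∑-const (allFin b) 0) (*-zeroʳ (length (allFin b))) ⟩
      0                                 ≤⟨ z≤n ⟩
      g⁻ * 0 + μ * ∑ E (𝟙 ∘ hits? Y?) ∎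
      where open ≤-Reasoning
    #Fin-≤ Y? (yes _) with g ≤? #Fin Y?
    ... | no g≰ = ≤-trans (≤-pred (≰⇒> g≰)) (≤-trans (≤-reflexive (sym (*-identityʳ g⁻))) (m≤m+n _ _))
    ... | yes g≤ = begin
      #Fin Y?                           ≤⟨ #Fin≤ Y? ⟩
      b                                 ≤⟨ b≤g⁻+μ ⟩
      g⁻ + μ                            ≡⟨ cong₂ _+_ (*-identityʳ g⁻) (*-identityʳ μ) ⟨
      g⁻ * 1 + μ * 1                    ≤⟨ +-monoʳ-≤ (g⁻ * 1) (*-monoʳ-≤ μ (hit Y? g≤)) ⟩
      g⁻ * 1 + μ * ∑ E (𝟙 ∘ hits? Y?) ∎
      where open ≤-Reasoning

    -- Induction on the number of digits. Each nonempty child contributes `g⁻ ^ r` weak types; the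
    -- single-digit bound for the set of these children trades them for weak types of the node and
    -- strong types that branch there.
    #words≤#strong : ∀ r {X : Pred (Word b r) 0ℓ} (X? : Decidable X) →
      ∑ (words b r) (𝟙 ∘ X?) ≤ g⁻ ^ r * 𝟙 (∃word? r X?) + ∑ (strongs r) (𝟙 ∘ realisesStrong? X?)
    #words≤#strong zero X? = begin
      𝟙 (X? []) + 0                   ≡⟨ +-identityʳ _ ⟩
      𝟙 (X? [])                       ≤⟨ 𝟙-mono ([] ,_) (X? []) (∃word? zero X?) ⟩
      𝟙 (∃word? zero X?)              ≡⟨ trans (+-identityʳ _) (+-identityʳ _) ⟨
      𝟙 (∃word? zero X?) + 0 + 0      ∎
      where open ≤-Reasoning
    #words≤#strong (suc r) {X} X? = begin
      ∑ (words b (suc r)) (𝟙 ∘ X?)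
        ≡⟨ ∑-pi (allFin b) (Vec.replicate r (allFin b)) (𝟙 ∘ X?) ⟩
      ∑ (allFin b) (λ c → ∑ (words b r) (λ w → 𝟙 (X? (c ∷ w))))
        ≤⟨ ∑-mono (allFin b) (λ c → #words≤#strong r (X? ∘ (c ∷_))) ⟩
      ∑ (allFin b) (λ c → p * 𝟙 (Y? c) + s c)
        ≡⟨ trans (∑-+ (allFin b) (λ c → p * 𝟙 (Y? c)) s) (cong (_+ ∑ (allFin b) s) (∑-*ˡ p (allFin b) (𝟙 ∘ Y?))) ⟩
      p * #Fin Y? + ∑ (allFin b) s
        ≤⟨ +-monoˡ-≤ (∑ (allFin b) s) (*-monoʳ-≤ p (#Fin-≤ Y? (Fin.any? Y?))) ⟩
      p * (g⁻ * 𝟙 (Fin.any? Y?) + μ * ∑ E (𝟙 ∘ hits? Y?)) + ∑ (allFin b) s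
        ≤⟨ +-monoˡ-≤ (∑ (allFin b) s) (*-monoʳ-≤ p (+-monoˡ-≤ _ (*-monoʳ-≤ g⁻
             (𝟙-mono (λ { (c , w , x) → c ∷ w , x }) (Fin.any? Y?) (∃word? (suc r) X?))))) ⟩
      p * (g⁻ * x + μ * ∑ E (𝟙 ∘ hits? Y?)) + ∑ (allFin b) s
        ≡⟨ lemma p g⁻ x μ (∑ E (𝟙 ∘ hits? Y?)) (∑ (allFin b) s) ⟩
      g⁻ * p * x + (∑ (allFin b) s + μ * p * ∑ E (𝟙 ∘ hits? Y?))
        ≡⟨ cong (g⁻ * p * x +_) (∑-strongs r (𝟙 ∘ realisesStrong? X?)) ⟨
      g⁻ * p * x + ∑ (strongs (suc r)) (𝟙 ∘ realisesStrong? X?) ∎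
      where
      open ≤-Reasoning
      p = g⁻ ^ r
      x = 𝟙 (∃word? (suc r) X?)
      s : Fin b → ℕ
      s c = ∑ (strongs r) (𝟙 ∘ realisesStrong? (X? ∘ (c ∷_)))
      Y? : Decidable (λ c → ∃ λ w → X (c ∷ w))
      Y? c = ∃word? r (X? ∘ (c ∷_))
      lemma : ∀ p g x m e s → p * (g * x + m * e) + s ≡ g * p * x + (s + m * p * e)
      lemma = solve-∀

    #words≤#types : ∀ r {X : Pred (Word b r) 0ℓ} (X? : Decidable X) →
      ∑ (words b r) (𝟙 ∘ X?) ≤ ∑ (types r) (𝟙 ∘ realises? X?)
    #words≤#types r X? = ≤-trans (#words≤#strong r X?) (≤-reflexive (sym (∑-types r (𝟙 ∘ realises? X?))))

-- Sets without chains along a diagonal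

length-upTo⋆ : ∀ k d → length (upTo k ⋆ d) ≡ k ^ d
length-upTo⋆ k d = trans (length-⋆ (upTo k) d) (cong (_^ d) (length-applyUpTo id k))

-- Expresses through bounded sums that `xs` misses at most `t` of the values below `k`.
record Trims (t k : ℕ) (xs : List ℕ) : Set where
  field
    short : length xs ≤ k
    loss  : ∀ f c → (∀ i → f i ≤ c) → ∑ (upTo k) f ≤ ∑ xs f + t * c
open Trims

trims-upTo : ∀ {a t k} → a ≤ k → k ≤ a + t → Trims t k (upTo a)
trims-upTo {a} {t} {k} a≤k k≤a+t .short = ≤-trans (≤-reflexive (length-applyUpTo id a)) a≤k
trims-upTo {a} {t} {k} a≤k k≤a+t .loss f c f≤c = begin
  ∑ (upTo k) f                                          ≡⟨ cong (λ n → ∑ (upTo n) f) (m+[n∸m]≡n a≤k) ⟨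
  ∑ (upTo (a + (k ∸ a))) f                              ≡⟨ ∑-upTo-+ a (k ∸ a) f ⟩
  ∑ (upTo a) f + ∑ (upTo (k ∸ a)) (λ i → f (a + i))     ≤⟨ +-monoʳ-≤ (∑ (upTo a) f) (∑-≤const (upTo (k ∸ a)) (λ i → f≤c (a + i))) ⟩
  ∑ (upTo a) f + length (upTo (k ∸ a)) * c              ≡⟨ cong (λ n → ∑ (upTo a) f + n * c) (length-applyUpTo id (k ∸ a)) ⟩
  ∑ (upTo a) f + (k ∸ a) * c                            ≤⟨ +-monoʳ-≤ (∑ (upTo a) f) (*-monoˡ-≤ c (m≤n+o⇒m∸n≤o k a k≤a+t)) ⟩
  ∑ (upTo a) f + t * c                                  ∎
  where open ≤-Reasoning

-- The number `d * k ^ (d - 1)`, a bound for the points on `d` faces of a cube of side `k`, in a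
-- recursive form that splits off one coordinate at a time.
surface : ℕ → ℕ → ℕ
surface zero    k = 0
surface (suc d) k = k ^ d + k * surface d k

surface-suc : ∀ d k → surface (suc d) k ≡ suc d * k ^ d
surface-suc zero    k = cong suc (*-zeroʳ k)
surface-suc (suc d) k = trans (cong (λ s → k ^ suc d + k * s) (surface-suc d k)) (lemma k d (k ^ d))
  where
  lemma : ∀ k d p → k * p + k * (suc d * p) ≡ suc (suc d) * (k * p)
  lemma = solve-∀

-- Trimming the first coordinate loses at most `t` full slices; the other coordinates are trimmed
-- inside each of the at most `k` slices that remain.
∑-trim : ∀ {t k d} {xss : Vec (List ℕ) d} → VecAll.All (Trims t k) xss → ∀ f c → (∀ u → f u ≤ c) →
  ∑ (upTo k ⋆ d) f ≤ ∑ (pi xss) f + t * c * surface d k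
∑-trim {t} {k} {zero}  []              f c f≤c = m≤m+n _ _
∑-trim {t} {k} {suc d} {xs ∷ xss} (p ∷ ps) f c f≤c = begin
  ∑ (upTo k ⋆ suc d) f
    ≡⟨ ∑-pi (upTo k) (Vec.replicate d (upTo k)) f ⟩
  ∑ (upTo k) (λ x → ∑ (upTo k ⋆ d) (λ v → f (x ∷ v)))
    ≤⟨ p .loss _ (k ^ d * c) (λ x → ≤-trans (∑-≤const (upTo k ⋆ d) (λ v → f≤c (x ∷ v)))
                                      (≤-reflexive (cong (_* c) (length-upTo⋆ k d)))) ⟩
  ∑ xs (λ x → ∑ (upTo k ⋆ d) (λ v → f (x ∷ v))) + t * (k ^ d * c)
    ≤⟨ +-monoˡ-≤ _ (∑-mono xs λ x → ∑-trim ps (λ v → f (x ∷ v)) c (λ v → f≤c (x ∷ v))) ⟩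
  ∑ xs (λ x → ∑ (pi xss) (λ v → f (x ∷ v)) + t * c * surface d k) + t * (k ^ d * c)
    ≡⟨ cong (_+ t * (k ^ d * c)) (trans (∑-+ xs _ _) (cong₂ _+_ (sym (∑-pi xs xss f)) (∑-const xs _))) ⟩
  ∑ (pi (xs ∷ xss)) f + length xs * (t * c * surface d k) + t * (k ^ d * c)
    ≤⟨ +-monoˡ-≤ _ (+-monoʳ-≤ (∑ (pi (xs ∷ xss)) f) (*-monoˡ-≤ (t * c * surface d k) (p .short))) ⟩
  ∑ (pi (xs ∷ xss)) f + k * (t * c * surface d k) + t * (k ^ d * c)
    ≡⟨ lemma (∑ (pi (xs ∷ xss)) f) k t c (surface d k) (k ^ d) ⟩
  ∑ (pi (xs ∷ xss)) f + t * c * surface (suc d) k ∎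
  where
  open ≤-Reasoning
  lemma : ∀ a k t c s p → a + k * (t * c * s) + t * (p * c) ≡ a + t * c * (p + k * s)
  lemma = solve-∀

-- `true` in `m` marks the coordinates that move together along a diagonal; the others stay fixed.
module Diagonal {d} (m : Vec Bool d) where

  shrunk : ∀ {d} → Vec Bool d → ℕ → Vec (List ℕ) d
  shrunk []          k = []
  shrunk (true ∷ m)  k = upTo k ∷ shrunk m k
  shrunk (false ∷ m) k = upTo (suc k) ∷ shrunk m k

  trims-shrunk : ∀ {d} (m : Vec Bool d) k → VecAll.All (Trims 1 (suc k)) (shrunk m k)
  trims-shrunk []          k = []
  trims-shrunk (true ∷ m)  k = trims-upTo (n≤1+n k) (≤-reflexive (+-comm 1 k)) ∷ trims-shrunk m k
  trims-shrunk (false ∷ m) k = trims-upTo ≤-refl (m≤m+n (suc k) 1) ∷ trims-shrunk m k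

  lower : ∀ {d} → Vec Bool d → Vec ℕ d → Maybe (Vec ℕ d)
  lower []          []          = just []
  lower (true ∷ m)  (zero ∷ u)  = nothing
  lower (true ∷ m)  (suc x ∷ u) = Maybe.map (x ∷_) (lower m u)
  lower (false ∷ m) (x ∷ u)     = Maybe.map (x ∷_) (lower m u)

  lower-true : ∀ {d} (m : Vec Bool d) u {v} → lower m u ≡ just v →
    ∀ c → lookup m c ≡ true → lookup u c ≡ suc (lookup v c)
  lower-true (true ∷ m)  (suc x ∷ u) eq c p with lower m u in eq′
  lower-true (true ∷ m)  (suc x ∷ u) refl zero    p | just v = refl
  lower-true (true ∷ m)  (suc x ∷ u) refl (suc c) p | just v = lower-true m u eq′ c p
  lower-true (false ∷ m) (x ∷ u)     eq c p with lower m u in eq′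
  lower-true (false ∷ m) (x ∷ u)     refl (suc c) p | just v = lower-true m u eq′ c p

  lower-false : ∀ {d} (m : Vec Bool d) u {v} → lower m u ≡ just v →
    ∀ c → lookup m c ≡ false → lookup u c ≡ lookup v c
  lower-false (true ∷ m)  (suc x ∷ u) eq c p with lower m u in eq′
  lower-false (true ∷ m)  (suc x ∷ u) refl (suc c) p | just v = lower-false m u eq′ c p
  lower-false (false ∷ m) (x ∷ u)     eq c p with lower m u in eq′
  lower-false (false ∷ m) (x ∷ u)     refl zero    p | just v = refl
  lower-false (false ∷ m) (x ∷ u)     refl (suc c) p | just v = lower-false m u eq′ c p

  orZero : ∀ {A : Set} → (A → ℕ) → Maybe A → ℕ
  orZero φ (just x) = φ x
  orZero φ nothing  = 0

  orZero-map : ∀ {A B : Set} (φ : B → ℕ) (h : A → B) y → orZero φ (Maybe.map h y) ≡ orZero (φ ∘ h) y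
  orZero-map φ h (just _) = refl
  orZero-map φ h nothing  = refl

  -- `lower` maps the points whose moving coordinates are all positive bijectively onto the box
  -- `shrunk m k`, and is undefined elsewhere.
  ∑-lower : ∀ {d} (m : Vec Bool d) k φ →
    ∑ (upTo (suc k) ⋆ d) (λ u → orZero φ (lower m u)) ≡ ∑ (pi (shrunk m k)) φ
  ∑-lower []         k φ = refl
  ∑-lower {suc d} (true ∷ m) k φ = begin
    ∑ (upTo (suc k) ⋆ suc d) (λ u → orZero φ (lower (true ∷ m) u))
      ≡⟨ ∑-pi (upTo (suc k)) (Vec.replicate d (upTo (suc k))) _ ⟩
    ∑ (upTo (suc k)) (λ x → ∑ (upTo (suc k) ⋆ d) (λ u → orZero φ (lower (true ∷ m) (x ∷ u))))
      ≡⟨ ∑-upTo-suc k _ ⟩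
    ∑ (upTo (suc k) ⋆ d) (λ _ → 0) + ∑ (upTo k) (λ x → ∑ (upTo (suc k) ⋆ d) (λ u → orZero φ (Maybe.map (x ∷_) (lower m u))))
      ≡⟨ cong₂ _+_ (trans (∑-const (upTo (suc k) ⋆ d) 0) (*-zeroʳ (length (upTo (suc k) ⋆ d))))
                   (∑-cong (upTo k) λ x → trans (∑-cong (upTo (suc k) ⋆ d) λ u → orZero-map φ (x ∷_) (lower m u))
                                                (∑-lower m k (φ ∘ (x ∷_)))) ⟩
    ∑ (upTo k) (λ x → ∑ (pi (shrunk m k)) (φ ∘ (x ∷_)))
      ≡⟨ ∑-pi (upTo k) (shrunk m k) φ ⟨
    ∑ (pi (shrunk (true ∷ m) k)) φ ∎
    where open ≡-Reasoning
  ∑-lower {suc d} (false ∷ m) k φ = begin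
    ∑ (upTo (suc k) ⋆ suc d) (λ u → orZero φ (lower (false ∷ m) u))
      ≡⟨ ∑-pi (upTo (suc k)) (Vec.replicate d (upTo (suc k))) _ ⟩
    ∑ (upTo (suc k)) (λ x → ∑ (upTo (suc k) ⋆ d) (λ u → orZero φ (Maybe.map (x ∷_) (lower m u))))
      ≡⟨ ∑-cong (upTo (suc k)) (λ x → trans (∑-cong (upTo (suc k) ⋆ d) λ u → orZero-map φ (x ∷_) (lower m u))
                                            (∑-lower m k (φ ∘ (x ∷_)))) ⟩
    ∑ (upTo (suc k)) (λ x → ∑ (pi (shrunk m k)) (φ ∘ (x ∷_)))
      ≡⟨ ∑-pi (upTo (suc k)) (shrunk m k) φ ⟨
    ∑ (pi (shrunk (false ∷ m) k)) φ ∎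
    where open ≡-Reasoning

  -- `_≺_` leaves the fixed coordinates open: in a `Chain` they agree because every member is
  -- compared with one `u` by `_≼_`.
  _≼_ _≺_ : Vec ℕ d → Vec ℕ d → Set
  v ≼ u = ∀ c → (lookup m c ≡ true → lookup v c ≤ lookup u c) × (lookup m c ≡ false → lookup v c ≡ lookup u c)
  v ≺ u = ∀ c → lookup m c ≡ true → lookup v c < lookup u c

  ≼-refl : ∀ {u} → u ≼ u
  ≼-refl c = (λ _ → ≤-refl) , λ _ → refl

  -- Indices run downwards: the chain is β 0 ≻ β 1 ≻ … ≻ β (j − 1), all below u.
  Chain : Pred (Vec ℕ d) 0ℓ → ℕ → Vec ℕ d → Set
  Chain U j u = ∃ λ (β : ℕ → Vec ℕ d) →
    (∀ i → i < j → U (β i)) × (∀ i → i < j → β i ≼ u) × (∀ i i′ → i < i′ → i′ < j → β i′ ≺ β i)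

  module _ {U : Pred (Vec ℕ d) 0ℓ} (U? : Decidable U) where

    -- Counts the members of `U` among `u` and the next `f` points down its diagonal; `f` is fuel.
    height : ℕ → Vec ℕ d → ℕ
    height zero    u = 𝟙 (U? u)
    height (suc f) u = 𝟙 (U? u) + orZero (height f) (lower m u)

    chain-0 : ∀ {u} → Chain U 0 u
    chain-0 {u} = (λ _ → u) , (λ _ ()) , (λ _ ()) , λ _ _ _ ()

    chain-1 : ∀ {u j} → U u → j ≤ 1 → Chain U j u
    chain-1 {u} Uu j≤1 = (λ _ → u) , (λ _ _ → Uu) , (λ _ _ → ≼-refl {u}) ,
      λ i i′ i<i′ i′<j → ⊥-elim (n≮0 (<-≤-trans i<i′ (≤-pred (≤-trans i′<j j≤1))))

    chain-lower : ∀ {u v j} → lower m u ≡ just v → Chain U j v → Chain U j u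
    chain-lower {u} {v} eq (β , Uβ , β≼ , β≺) = β , Uβ ,
      (λ i i<j c → (λ p → ≤-trans (proj₁ (β≼ i i<j c) p) (≤-trans (n≤1+n _) (≤-reflexive (sym (lower-true m u eq c p)))))
                 , (λ p → trans (proj₂ (β≼ i i<j c) p) (sym (lower-false m u eq c p)))) ,
      β≺

    chain-suc : ∀ {u v j} → U u → lower m u ≡ just v → Chain U j v → Chain U (suc j) u
    chain-suc {u} {v} {j} Uu eq ch@(β , Uβ , β≼ , β≺) = β′ , Uβ′ , β′≼ , β′≺
      where
      β′ : ℕ → Vec ℕ d
      β′ zero    = u
      β′ (suc i) = β i

      Uβ′ : ∀ i → i < suc j → U (β′ i)
      Uβ′ zero    _         = Uu
      Uβ′ (suc i) (s≤s i<j) = Uβ i i<j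

      β′≼ : ∀ i → i < suc j → β′ i ≼ u
      β′≼ zero    _         = ≼-refl {u}
      β′≼ (suc i) (s≤s i<j) = proj₁ (proj₂ (proj₂ (chain-lower eq ch))) i i<j

      β′≺ : ∀ i i′ → i < i′ → i′ < suc j → β′ i′ ≺ β′ i
      β′≺ zero    (suc i′) _          (s≤s i′<j) c p =
        ≤-trans (s≤s (proj₁ (β≼ i′ i′<j c) p)) (≤-reflexive (sym (lower-true m u eq c p)))
      β′≺ (suc i) (suc i′) (s≤s i<i′) (s≤s i′<j) = β≺ i i′ i<i′ i′<j

    -- The counted members lie on one diagonal, hence form a chain; the topmost `j` of them are
    -- taken.
    chain : ∀ f u j → j ≤ height f u → Chain U j u
    chain zero u j j≤ with U? u
    ... | yes Uu = chain-1 Uu j≤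
    chain zero u zero j≤ | no _ = chain-0 {u}
    chain (suc f) u j j≤ with U? u | lower m u in eq
    ... | yes Uu | nothing = chain-1 Uu j≤
    ... | no _   | just v  = chain-lower eq (chain f v j j≤)
    chain (suc f) u zero    j≤       | no _   | nothing = chain-0 {u}
    chain (suc f) u zero    j≤       | yes Uu | just v  = chain-0 {u}
    chain (suc f) u (suc j) (s≤s j≤) | yes Uu | just v  = chain-suc Uu eq (chain f v j j≤)

    module _ (c₀ : Fin d) (moves : lookup m c₀ ≡ true) where

      -- The moving coordinate `c₀` drops by one at every step, so its value is enough fuel to reach
      -- the end of the diagonal.
      rank : Vec ℕ d → ℕ
      rank u = height (lookup u c₀) u

      rank-lower : ∀ u → rank u ≡ 𝟙 (U? u) + orZero rank (lower m u)
      rank-lower u with lookup u c₀ in eq₀ | lower m u in eq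
      ... | zero  | nothing = sym (+-identityʳ _)
      ... | zero  | just v  = ⊥-elim (1+n≢0 (trans (sym (lower-true m u eq c₀ moves)) eq₀))
      ... | suc y | nothing rewrite eq = refl
      ... | suc y | just v  rewrite eq =
        cong (λ y → 𝟙 (U? u) + height y v) (suc-injective (trans (sym eq₀) (lower-true m u eq c₀ moves)))

      -- Along a diagonal the indicator of U is the difference of consecutive ranks, so its sum telescopes
      -- to the ranks on the upper faces of the cube.
      ∑-chainless : ∀ h → (∀ u → ¬ Chain U h u) → ∀ k → ∑ (upTo k ⋆ d) (𝟙 ∘ U?) ≤ h * surface d k
      ∑-chainless h ¬chain zero    = ≤-trans (≤-reflexive (empty c₀ _)) z≤n
        where
        empty : ∀ {d} → Fin d → ∀ f → ∑ (upTo 0 ⋆ d) f ≡ 0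
        empty {suc d} _ f = refl
      ∑-chainless h ¬chain (suc k) = +-cancelʳ-≤ (∑ (pi (shrunk m k)) rank) _ _ (begin
        ∑ (upTo (suc k) ⋆ d) (𝟙 ∘ U?) + ∑ (pi (shrunk m k)) rank
          ≡⟨ cong (∑ (upTo (suc k) ⋆ d) (𝟙 ∘ U?) +_) (∑-lower m k rank) ⟨
        ∑ (upTo (suc k) ⋆ d) (𝟙 ∘ U?) + ∑ (upTo (suc k) ⋆ d) (λ u → orZero rank (lower m u))
          ≡⟨ ∑-+ (upTo (suc k) ⋆ d) (𝟙 ∘ U?) _ ⟨
        ∑ (upTo (suc k) ⋆ d) (λ u → 𝟙 (U? u) + orZero rank (lower m u))
          ≡⟨ ∑-cong (upTo (suc k) ⋆ d) rank-lower ⟨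
        ∑ (upTo (suc k) ⋆ d) rank
          -- A rank of `h` or more would give a chain of `h` members; and `shrunk` drops at most one
          -- value per coordinate.
          ≤⟨ ∑-trim (trims-shrunk m k) rank h (λ u → <⇒≤ (≰⇒> (¬chain u ∘ chain (lookup u c₀) u h))) ⟩
        ∑ (pi (shrunk m k)) rank + 1 * h * surface d (suc k)
          ≡⟨ trans (+-comm (∑ (pi (shrunk m k)) rank) _) (cong (λ x → x * surface d (suc k) + ∑ (pi (shrunk m k)) rank) (*-identityˡ h)) ⟩
        h * surface d (suc k) + ∑ (pi (shrunk m k)) rank ∎)
        where open ≤-Reasoning

-- Shattering

increasing⇒injective : ∀ {g b} {e : Vec (Fin b) g} → Increasing e → ∀ {i j} → lookup e i ≡ lookup e j → i ≡ j
increasing⇒injective {e = e} inc {i} {j} eq with Fin.<-cmp i j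
... | tri< i<j _ _ = ⊥-elim (<-irrefl (cong toℕ eq) (inc i j i<j))
... | tri≈ _ i≡j _ = i≡j
... | tri> _ _ j<i = ⊥-elim (<-irrefl (cong toℕ (sym eq)) (inc j i j<i))

𝟙-cover : ∀ {P Q R S : Set} (p : Dec P) (q : Dec Q) (r : Dec R) (s : Dec S) →
  (P → Q) → (¬ S → R) → 𝟙 p ≤ 𝟙 q * 𝟙 r + 𝟙 s * 𝟙 p
𝟙-cover (no _)  q       r       s       f g = z≤n
𝟙-cover (yes _) q       r       (yes _) f g = m≤n+m 1 _
𝟙-cover (yes _) (yes _) (yes _) (no _)  f g = ≤-refl
𝟙-cover (yes p) (no ¬q) r       (no _)  f g = ⊥-elim (¬q (f p))
𝟙-cover (yes _) (yes _) (no ¬r) (no ¬s) f g = ⊥-elim (¬r (g ¬s))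

𝟙*-≤ : ∀ {P : Set} (p : Dec P) {m n} → (P → m ≤ n) → 𝟙 p * m ≤ n
𝟙*-≤ (yes p) m≤n = ≤-trans (≤-reflexive (+-identityʳ _)) (m≤n p)
𝟙*-≤ (no _)  m≤n = z≤n

glue : ∀ {b r d} → Vec ℕ d → Vec (Word b r) d → Vec ℕ d
glue {b} {r} = Vec.zipWith (λ x w → x * b ^ r + val w)

-- Division with remainder by `b ^ r` in every coordinate: each point lies in exactly one cube `u`,
-- at exactly one position `V`.
∑-glue : ∀ b r k d (f : Vec ℕ d → ℕ) →
  ∑ (upTo (k * b ^ r) ⋆ d) f ≡ ∑ (upTo k ⋆ d) (λ u → ∑ (words b r ⋆ d) (λ V → f (glue u V)))
∑-glue b r k zero    f = sym (+-identityʳ _)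
∑-glue b r k (suc d) f = begin
  ∑ (upTo (k * b ^ r) ⋆ suc d) f
    ≡⟨ ∑-pi (upTo (k * b ^ r)) (Vec.replicate d (upTo (k * b ^ r))) f ⟩
  ∑ (upTo (k * b ^ r)) (λ x → ∑ (upTo (k * b ^ r) ⋆ d) (λ v → f (x ∷ v)))
    ≡⟨ ∑-cong (upTo (k * b ^ r)) (λ x → ∑-glue b r k d (λ v → f (x ∷ v))) ⟩
  ∑ (upTo (k * b ^ r)) F
    ≡⟨ ∑-upTo-* k (b ^ r) F ⟩
  ∑ (upTo k) (λ i → ∑ (upTo (b ^ r)) (λ j → F (i * b ^ r + j)))
    ≡⟨ ∑-cong (upTo k) (λ i → ∑-words b r (λ j → F (i * b ^ r + j))) ⟨
  ∑ (upTo k) (λ i → ∑ (words b r) (λ w → F (i * b ^ r + val w)))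
    ≡⟨ ∑-cong (upTo k) (λ i → ∑-swap (words b r) (upTo k ⋆ d) _) ⟩
  ∑ (upTo k) (λ i → ∑ (upTo k ⋆ d) (λ u → ∑ (words b r) (λ w → ∑ (words b r ⋆ d) (λ V → f (i * b ^ r + val w ∷ glue u V)))))
    ≡⟨ ∑-cong (upTo k) (λ i → ∑-cong (upTo k ⋆ d) (λ u → ∑-pi (words b r) (Vec.replicate d (words b r)) (λ V → f (glue (i ∷ u) V)))) ⟨
  ∑ (upTo k) (λ i → ∑ (upTo k ⋆ d) (λ u → ∑ (words b r ⋆ suc d) (λ V → f (glue (i ∷ u) V))))
    ≡⟨ ∑-pi (upTo k) (Vec.replicate d (upTo k)) (λ u → ∑ (words b r ⋆ suc d) (λ V → f (glue u V))) ⟨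
  ∑ (upTo k ⋆ suc d) (λ u → ∑ (words b r ⋆ suc d) (λ V → f (glue u V))) ∎
  where
  open ≡-Reasoning
  F : ℕ → ℕ
  F x = ∑ (upTo k ⋆ d) (λ u → ∑ (words b r ⋆ d) (λ V → f (x ∷ glue u V)))

-- A strict inequality between cubes holds wherever the points lie inside them; this is what lifts
-- strict copies.
glue-<ˡ : ∀ {b r d} (u u′ : Vec ℕ d) (V V′ : Vec (Word b r) d) c →
  lookup u c < lookup u′ c → lookup (glue u V) c < lookup (glue u′ V′) c
glue-<ˡ {b} {r} u u′ V V′ c u<u′
  rewrite Vec.lookup-zipWith (λ x w → x * b ^ r + val w) c u V | Vec.lookup-zipWith (λ x w → x * b ^ r + val w) c u′ V′ = begin-strict
  x * b ^ r + val (lookup V c)    <⟨ +-monoʳ-< (x * b ^ r) (val-< (lookup V c)) ⟩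
  x * b ^ r + b ^ r               ≡⟨ +-comm (x * b ^ r) (b ^ r) ⟩
  suc x * b ^ r                   ≤⟨ *-monoˡ-≤ (b ^ r) u<u′ ⟩
  lookup u′ c * b ^ r             ≤⟨ m≤m+n _ (val (lookup V′ c)) ⟩
  lookup u′ c * b ^ r + val (lookup V′ c) ∎
  where
  open ≤-Reasoning
  x = lookup u c

glue-<ʳ : ∀ {b r d} (u u′ : Vec ℕ d) (V V′ : Vec (Word b r) d) c →
  lookup u c ≡ lookup u′ c → val (lookup V c) < val (lookup V′ c) → lookup (glue u V) c < lookup (glue u′ V′) c
glue-<ʳ {b} {r} u u′ V V′ c eq v<v′
  rewrite Vec.lookup-zipWith (λ x w → x * b ^ r + val w) c u V | Vec.lookup-zipWith (λ x w → x * b ^ r + val w) c u′ V′ | eq =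
  +-monoʳ-< (lookup u′ c * b ^ r) v<v′

∃words? : ∀ {b r} d {A : Pred (Vec (Word b r) d) 0ℓ} → Decidable A → Dec (∃ A)
∃words? zero    A? = map′ ([] ,_) (λ { ([] , a) → a }) (A? [])
∃words? (suc d) A? = map′ (λ { (w , V , a) → w ∷ V , a }) (λ { (w ∷ V , a) → w , V , a })
  (∃word? _ λ w → ∃words? d (A? ∘ (w ∷_)))

^-distribʳ-* : ∀ d m n → (m * n) ^ d ≡ m ^ d * n ^ d
^-distribʳ-* zero    m n = refl
^-distribʳ-* (suc d) m n = trans (cong (m * n *_) (^-distribʳ-* d m n)) (lemma m n (m ^ d) (n ^ d))
  where
  lemma : ∀ a b c d → a * b * (c * d) ≡ a * c * (b * d)
  lemma = solve-∀

All-replicate : ∀ {A : Set} {P : Pred A 0ℓ} {d x} → P x → VecAll.All P (Vec.replicate d x)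
All-replicate {d = zero}  p = []
All-replicate {d = suc d} p = p ∷ All-replicate p

module Shattering (g⁻ b μ : ℕ) (E : List (Vec (Fin b) (suc g⁻))) (r : ℕ) where
  open Types g⁻ b μ E

  -- A nested form: the first words whose section shatters the remaining types must realise the
  -- first type. Words on later coordinates may thus depend on earlier ones.
  Shatters : ∀ {d} → Pred (Vec (Word b r) d) 0ℓ → Vec (Type r) d → Set
  Shatters A []      = A []
  Shatters A (t ∷ T) = Realises (λ w → Shatters (λ V → A (w ∷ V)) T) t

  shatters? : ∀ {d} {A : Pred (Vec (Word b r) d) 0ℓ} → Decidable A → Decidable (Shatters A)
  shatters? A? []      = A? []
  shatters? A? (t ∷ T) = realises? (λ w → shatters? (A? ∘ (w ∷_)) T) t

  -- The words are chosen from the first coordinate on; each choice leaves a section that shatters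
  -- the remaining types.
  shatters⇒zone : ∀ {d} {A : Pred (Vec (Word b r) d) 0ℓ} T → Shatters A T → ∀ (z : Fin d → Fin g) →
    ∃ λ V → A V × ∀ c → Zone (lookup T c) (z c) (lookup V c)
  shatters⇒zone []      a z = [] , a , λ ()
  shatters⇒zone (t ∷ T) R z =
    let w , S , zw = realises⇒zone t R (z zero)
        V , a , zV = shatters⇒zone T S (z ∘ suc)
    in w ∷ V , a , λ { zero → zw ; (suc c) → zV c }

  shatters⇒ordered : ∀ {d} {A : Pred (Vec (Word b r) d) 0ℓ} T → Shatters A T →
    ∀ c {s} → lookup T c ≡ just s → Ordered s
  shatters⇒ordered (just s ∷ T) R zero    refl = realisesStrong⇒ordered s R
  shatters⇒ordered (t ∷ T)      R (suc c) eq   =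
    shatters⇒ordered T (proj₁ (proj₂ (realises⇒zone t R zero))) c eq

  module _ (b≤g⁻+μ : b ≤ g⁻ + μ)
           (hit : ∀ {Y : Pred (Fin b) 0ℓ} (Y? : Decidable Y) → g ≤ #Fin Y? → 1 ≤ ∑ E (𝟙 ∘ hits? Y?)) where

    -- Tensorisation: the section over each first word satisfies the bound by induction; after
    -- exchanging the sums, `#words≤#types` treats the first coordinate for each fixed `T`.
    #≤#shattered : ∀ {d} {A : Pred (Vec (Word b r) d) 0ℓ} (A? : Decidable A) →
      ∑ (words b r ⋆ d) (𝟙 ∘ A?) ≤ ∑ (types r ⋆ d) (𝟙 ∘ shatters? A?)
    #≤#shattered {zero}  A? = ≤-refl
    #≤#shattered {suc d} A? = begin
      ∑ (words b r ⋆ suc d) (𝟙 ∘ A?)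
        ≡⟨ ∑-pi (words b r) (Vec.replicate d (words b r)) (𝟙 ∘ A?) ⟩
      ∑ (words b r) (λ w → ∑ (words b r ⋆ d) (λ V → 𝟙 (A? (w ∷ V))))
        ≤⟨ ∑-mono (words b r) (λ w → #≤#shattered (A? ∘ (w ∷_))) ⟩
      ∑ (words b r) (λ w → ∑ (types r ⋆ d) (λ T → 𝟙 (shatters? (A? ∘ (w ∷_)) T)))
        ≡⟨ ∑-swap (words b r) (types r ⋆ d) _ ⟩
      ∑ (types r ⋆ d) (λ T → ∑ (words b r) (λ w → 𝟙 (shatters? (A? ∘ (w ∷_)) T)))
        ≤⟨ ∑-mono (types r ⋆ d) (λ T → #words≤#types b≤g⁻+μ hit r (λ w → shatters? (A? ∘ (w ∷_)) T)) ⟩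
      ∑ (types r ⋆ d) (λ T → ∑ (types r) (λ t → 𝟙 (shatters? A? (t ∷ T))))
        ≡⟨ ∑-swap (types r ⋆ d) (types r) _ ⟩
      ∑ (types r) (λ t → ∑ (types r ⋆ d) (λ T → 𝟙 (shatters? A? (t ∷ T))))
        ≡⟨ ∑-pi (types r) (Vec.replicate d (types r)) (𝟙 ∘ shatters? A?) ⟨
      ∑ (types r ⋆ suc d) (𝟙 ∘ shatters? A?) ∎
      where open ≤-Reasoning

  IsStrong : Type r → Set
  IsStrong t = ∃ λ s → t ≡ just s

  isStrong? : Decidable IsStrong
  isStrong? (just s) = yes (s , refl)
  isStrong? nothing  = no λ ()

  #strong : ∀ {d} → Vec (Type r) d → ℕ
  #strong T = #Fin (λ c → isStrong? (lookup T c))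

  Good Bad : ∀ (n : ℕ) {d} → Pred (Vec (Type r) d) 0ℓ
  Good n T = n ≤ #strong T
  Bad  n T = #strong T < n

  good? : ∀ n {d} → Decidable (Good n {d})
  good? n T = n ≤? #strong T

  bad? : ∀ n {d} → Decidable (Bad n {d})
  bad? n T = #strong T <? n

  #bad : ℕ → ℕ → ℕ
  #bad n d = ∑ (types r ⋆ d) (𝟙 ∘ bad? n)

  #strong-∷ : ∀ {d} t (T : Vec (Type r) d) → #strong (t ∷ T) ≡ 𝟙 (isStrong? t) + #strong T
  #strong-∷ {d} t T = ∑-allFin-suc d (λ c → 𝟙 (isStrong? (lookup (t ∷ T) c)))

  module _ (α : ℕ) .{{_ : NonZero α}} where

    -- A generating function: `α` marks the weak coordinates, so that vectors with many of them
    -- weigh much.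
    weight : Type r → ℕ
    weight nothing  = α
    weight (just _) = 1

    ∏weight : ∀ {d} → Vec (Type r) d → ℕ
    ∏weight = Vec.foldr _ (λ t p → weight t * p) 1

    ∏weight-≥ : ∀ {d} (T : Vec (Type r) d) → α ^ (d ∸ #strong T) ≤ ∏weight T
    ∏weight-≥ []      = ≤-refl
    ∏weight-≥ {suc d} (t ∷ T) = ≤-trans (≤-reflexive (cong (λ s → α ^ (suc d ∸ s)) (#strong-∷ t T))) (step t)
      where
      step : ∀ t → α ^ (suc d ∸ (𝟙 (isStrong? t) + #strong T)) ≤ weight t * ∏weight T
      step (just s) = ≤-trans (∏weight-≥ T) (≤-reflexive (sym (+-identityʳ _)))
      step nothing  = ≤-trans (≤-reflexive (cong (α ^_) (+-∸-assoc 1 (#Fin≤ (λ c → isStrong? (lookup T c))))))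
                              (*-monoʳ-≤ α (∏weight-≥ T))

    -- The hypothesis on `α` keeps all weak types together at most as heavy as `M * b ^ r`, which
    -- also bounds the strong types.
    ∑-weight : g ≤ b → α * g⁻ ^ r ≤ M * b ^ r → ∑ (types r) weight ≤ 2 * (M * b ^ r)
    ∑-weight g≤b α≤ = begin
      ∑ (types r) weight                         ≡⟨ ∑-types r weight ⟩
      g⁻ ^ r * α + ∑ (strongs r) (λ _ → 1)       ≡⟨ cong₂ _+_ (*-comm (g⁻ ^ r) α) (sym (length-∑ (strongs r))) ⟩
      α * g⁻ ^ r + length (strongs r)            ≤⟨ +-mono-≤ α≤ (≤-trans (m≤m+n _ (M * g⁻ ^ r)) (length-strongs-≤ g≤b r)) ⟩
      M * b ^ r + M * b ^ r                      ≡⟨ cong (M * b ^ r +_) (+-identityʳ _) ⟨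
      2 * (M * b ^ r)                            ∎
      where open ≤-Reasoning

    -- A bad type has at least e weak coordinates, hence weight at least α ^ e.
    #bad-weight : ∀ n d e → e + n ≤ suc d → #bad n d * α ^ e ≤ ∑ (types r) weight ^ d
    #bad-weight n d e e+n≤ = begin
      #bad n d * α ^ e                                  ≡⟨ ∑-*ʳ (α ^ e) (types r ⋆ d) (𝟙 ∘ bad? n) ⟨
      ∑ (types r ⋆ d) (λ T → 𝟙 (bad? n T) * α ^ e)      ≤⟨ ∑-mono (types r ⋆ d) (λ T → 𝟙*-≤ (bad? n T) (heavy T)) ⟩
      ∑ (types r ⋆ d) ∏weight                           ≡⟨ ∑-⋆-* (types r) d weight ⟩
      ∑ (types r) weight ^ d                            ∎
      where
      open ≤-Reasoning
      heavy : ∀ T → Bad n T → α ^ e ≤ ∏weight T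
      heavy T bad = ≤-trans (^-monoʳ-≤ α (m+n≤o⇒m≤o∸n e (≤-pred
        (≤-trans (≤-reflexive (sym (+-suc e (#strong T)))) (≤-trans (+-monoʳ-≤ e bad) e+n≤))))) (∏weight-≥ T)

  length-types-≤ : 1 ≤ M → g ≤ b → length (types r) ≤ M * b ^ r
  length-types-≤ 1≤M g≤b = begin
    length (types r)                          ≡⟨ trans (length-∑ (types r)) (∑-types r (λ _ → 1)) ⟩
    g⁻ ^ r * 1 + ∑ (strongs r) (λ _ → 1)      ≡⟨ cong₂ _+_ (*-comm (g⁻ ^ r) 1) (sym (length-∑ (strongs r))) ⟩
    1 * g⁻ ^ r + length (strongs r)           ≤⟨ +-monoˡ-≤ _ (*-monoˡ-≤ (g⁻ ^ r) 1≤M) ⟩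
    M * g⁻ ^ r + length (strongs r)           ≡⟨ +-comm (M * g⁻ ^ r) _ ⟩
    length (strongs r) + M * g⁻ ^ r           ≤⟨ length-strongs-≤ g≤b r ⟩
    M * b ^ r                                 ∎
    where open ≤-Reasoning

-- Copies of the poset from chains of cubes

module Copies {n} {_⊑_ : Fin n → Fin n → Set} (_⊑?_ : ∀ p q → Dec (p ⊑ q))
  (⊑-refl : ∀ {p} → p ⊑ p) (⊑-trans : ∀ {p q r} → p ⊑ q → q ⊑ r → p ⊑ r)
  (h : ℕ) (ℓ : Fin n → ℕ) (ℓ< : ∀ p → ℓ p < h) (ℓ-anti : ∀ {p q} → p ⊑ q → p ≢ q → ℓ q < ℓ p) where

  -- Both the order and its failure are witnessed by strict inequalities, the kind that passes from
  -- cubes to points.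
  StrictCopy : ∀ {d} → Pred (Vec ℕ d) 0ℓ → Set
  StrictCopy {d} F = Σ (Fin n → Vec ℕ d) λ π → (∀ p → F (π p))
    × (∀ {p q} → p ⊑ q → p ≢ q → ∀ c → lookup (π p) c < lookup (π q) c)
    × (∀ {p q} → ¬ p ⊑ q → ∃ λ c → lookup (π q) c < lookup (π p) c)

  -- The value of the element p on the coordinate assigned to the element q.
  value : Fin n → Fin n → ℕ
  value q p = 𝟙 (q ⊑? p) * h + (h ∸ suc (ℓ p))

  colevel< : ∀ p → h ∸ suc (ℓ p) < h
  colevel< p = ∸-monoʳ-< {h} (s≤s z≤n) (ℓ< p)

  value< : ∀ q p → value q p < h + h
  value< q p = +-mono-≤-< (≤-trans (*-monoˡ-≤ h (𝟙≤1 (q ⊑? p))) (≤-reflexive (*-identityˡ h))) (colevel< p)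

  -- From `p` to `p′` the bonus `h` can only be gained, by transitivity, and the reversed level
  -- grows strictly.
  value-⊑ : ∀ q {p p′} → p ⊑ p′ → p ≢ p′ → value q p < value q p′
  value-⊑ q {p} {p′} p⊑p′ p≢p′ = +-mono-≤-<
    (*-monoˡ-≤ h (𝟙-mono (λ q⊑p → ⊑-trans q⊑p p⊑p′) (q ⊑? p) (q ⊑? p′)))
    (∸-monoʳ-< (s≤s (ℓ-anti p⊑p′ p≢p′)) (ℓ< p))

  -- On its own coordinate `p` gets the bonus `h`, while `q` stays below `h`.
  value-⋢ : ∀ {p q} → ¬ p ⊑ q → value p q < value p p
  value-⋢ {p} {q} p⋢q with p ⊑? q | p ⊑? p
  ... | yes p⊑q | _     = ⊥-elim (p⋢q p⊑q)
  ... | _  | no p⋢p     = ⊥-elim (p⋢p ⊑-refl)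
  ... | no _    | yes _ = <-≤-trans (colevel< q) (≤-trans (m≤m+n h 0) (m≤m+n _ _))

  strictCopy-glue : ∀ {b r d} {F : Pred (Vec ℕ d) 0ℓ} →
    StrictCopy (λ u → ∃ λ V → F (glue {b} {r} u V)) → StrictCopy F
  strictCopy-glue (π , Fπ , up , sep) =
    (λ p → glue (π p) (proj₁ (Fπ p))) , (λ p → proj₂ (Fπ p)) ,
    (λ {p} {q} p⊑q p≢q c → glue-<ˡ (π p) (π q) _ _ c (up p⊑q p≢q c)) ,
    λ {p} {q} p⋢q → let c , lt = sep p⋢q in c , glue-<ˡ (π q) (π p) _ _ c lt

  module _ (g⁻ b μ : ℕ) (E : List (Vec (Fin b) (suc g⁻))) (r : ℕ) (2h≡g : h + h ≡ suc g⁻)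
    {d} (n<d : n < d) {F : Pred (Vec ℕ d) 0ℓ} (F? : Decidable F) where
    open Types g⁻ b μ E
    open Shattering g⁻ b μ E r

    Block : Vec ℕ d → Pred (Vec (Word b r) d) 0ℓ
    Block u V = F (glue u V)

    block? : ∀ u → Decidable (Block u)
    block? u V = F? (glue u V)

    module _ (T : Vec (Type r) d) {e : Vec (Fin d) n} (e-hits : Hits (λ c → IsStrong (lookup T c)) e) where

      index? : ∀ c → Dec (∃ λ q → lookup e q ≡ c)
      index? c = Fin.any? λ q → lookup e q Fin.≟ c

      moving : Vec Bool d
      moving = Vec.tabulate (λ c → not (does (index? c)))

      open Diagonal moving

      moving-true : ∀ c → ¬ (∃ λ q → lookup e q ≡ c) → lookup moving c ≡ true
      moving-true c ¬q rewrite Vec.lookup∘tabulate (λ c → not (does (index? c))) c with index? c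
      ... | yes q = ⊥-elim (¬q q)
      ... | no _  = refl

      moving-false : ∀ c → (∃ λ q → lookup e q ≡ c) → lookup moving c ≡ false
      moving-false c q rewrite Vec.lookup∘tabulate (λ c → not (does (index? c))) c with index? c
      ... | yes _ = refl
      ... | no ¬q = ⊥-elim (¬q q)

      -- The `n` chosen coordinates cannot exhaust `d > n`; one that is left over serves as `c₀` in
      -- the chain argument.
      moves : ∃ λ c → lookup moving c ≡ true
      moves =
        let c , ¬q = Fin.¬∀⟶∃¬ d _ index? λ inv →
              let i , j , i<j , eq = Fin.pigeonhole n<d (proj₁ ∘ inv)
              in Fin.<⇒≢ i<j (trans (sym (proj₂ (inv i))) (trans (cong (lookup e) eq) (proj₂ (inv j))))
        in c , moving-true c ¬q

      zone : Fin n → Fin d → Fin g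
      zone p c with index? c
      ... | yes (q , _) = fromℕ< (subst (value q p <_) 2h≡g (value< q p))
      -- A default value: on a moving coordinate the cubes decide the order.
      ... | no _        = zero

      zone-value : ∀ p q → toℕ (zone p (lookup e q)) ≡ value q p
      zone-value p q with index? (lookup e q)
      ... | no ¬q       = ⊥-elim (¬q (q , refl))
      ... | yes (i , eq) rewrite increasing⇒injective {e = e} (proj₁ e-hits) {i} {q} eq = Fin.toℕ-fromℕ< _

      U : Pred (Vec ℕ d) 0ℓ
      U u = Shatters (Block u) T

      -- The element `p` goes to a point of the cube `β (ℓ p)` in the zones `zone p`. On the chosen
      -- coordinates all cubes of the chain agree and the zones decide; on the others the cubes
      -- increase strictly.
      chain⇒copy : ∀ u → Chain U h u → StrictCopy F
      chain⇒copy u (β , Uβ , β≼ , β≺) = π , (λ p → proj₁ (proj₂ (choice p))) , up , sep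
        where
        choice : ∀ p → ∃ λ V → Block (β (ℓ p)) V × ∀ c → Zone (lookup T c) (zone p c) (lookup V c)
        choice p = shatters⇒zone T (Uβ (ℓ p) (ℓ< p)) (zone p)

        V : Fin n → Vec (Word b r) d
        V p = proj₁ (choice p)

        π : Fin n → Vec ℕ d
        π p = glue (β (ℓ p)) (V p)

        level : ∀ p q i → lookup (β (ℓ p)) (lookup e i) ≡ lookup (β (ℓ q)) (lookup e i)
        level p q i = let m = moving-false (lookup e i) (i , refl) in
          trans (proj₂ (β≼ (ℓ p) (ℓ< p) (lookup e i)) m) (sym (proj₂ (β≼ (ℓ q) (ℓ< q) (lookup e i)) m))

        fine : ∀ p q i → value i p < value i q → lookup (π p) (lookup e i) < lookup (π q) (lookup e i)
        fine p q i v<v = glue-<ʳ (β (ℓ p)) (β (ℓ q)) (V p) (V q) (lookup e i) (level p q i)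
          (let s , eq = proj₂ e-hits i
               lt = subst₂ _<_ (sym (zone-value p i)) (sym (zone-value q i)) v<v
           in zone-< s (shatters⇒ordered T (Uβ (ℓ p) (ℓ< p)) (lookup e i) eq) lt
                (subst (λ t → Zone t (zone p (lookup e i)) (lookup (V p) (lookup e i))) eq (proj₂ (proj₂ (choice p)) (lookup e i)))
                (subst (λ t → Zone t (zone q (lookup e i)) (lookup (V q) (lookup e i))) eq (proj₂ (proj₂ (choice q)) (lookup e i))))

        up : ∀ {p q} → p ⊑ q → p ≢ q → ∀ c → lookup (π p) c < lookup (π q) c
        up {p} {q} p⊑q p≢q c with index? c
        ... | yes (i , refl) = fine p q i (value-⊑ i p⊑q p≢q)
        -- A larger element has a smaller level, and the chain is indexed downwards.
        ... | no ¬q          = glue-<ˡ (β (ℓ p)) (β (ℓ q)) (V p) (V q) c (β≺ (ℓ q) (ℓ p) (ℓ-anti p⊑q p≢q) (ℓ< p) c (moving-true c ¬q))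

        sep : ∀ {p q} → ¬ p ⊑ q → ∃ λ c → lookup (π q) c < lookup (π p) c
        sep {p} {q} p⋢q = lookup e p , fine q p p (value-⋢ p⋢q)

      #shattered-≤ : ¬ StrictCopy F → ∀ k →
        ∑ (upTo k ⋆ d) (λ u → 𝟙 (shatters? (block? u) T)) ≤ h * surface d k
      #shattered-≤ ¬copy = ∑-chainless (λ u → shatters? (block? u) T) (proj₁ moves) (proj₂ moves) h
        (λ u → ¬copy ∘ chain⇒copy u)

    Contracted : Pred (Vec ℕ d) 0ℓ
    Contracted u = ∃ (Block u)

    contracted? : Decidable Contracted
    contracted? u = ∃words? d (block? u)

    -- A good type is counted as it is. A bad one is charged to its cube, which contains a point of
    -- `F` as soon as it shatters anything.
    split : ∀ u T → 𝟙 (shatters? (block? u) T) ≤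
      𝟙 (contracted? u) * 𝟙 (bad? n T) + 𝟙 (good? n T) * 𝟙 (shatters? (block? u) T)
    split u T = 𝟙-cover (shatters? (block? u) T) (contracted? u) (bad? n T) (good? n T)
      (λ S → let V , a , _ = shatters⇒zone T S (λ _ → zero) in V , a) ≰⇒>

    good-≤ : ¬ StrictCopy F → ∀ k T →
      𝟙 (good? n T) * ∑ (upTo k ⋆ d) (λ u → 𝟙 (shatters? (block? u) T)) ≤ h * surface d k
    good-≤ ¬copy k T = 𝟙*-≤ (good? n T) λ n≤ →
      let e , e-hits = #Fin-select n (λ c → isStrong? (lookup T c)) n≤
      in #shattered-≤ T {e} e-hits ¬copy k

    module _ (b≤g⁻+μ : b ≤ g⁻ + μ)
             (hit : ∀ {Y : Pred (Fin b) 0ℓ} (Y? : Decidable Y) → g ≤ #Fin Y? → 1 ≤ ∑ E (𝟙 ∘ hits? Y?)) where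

      -- The points in a cube are counted by shattered types. Bad types cost at most `#bad n d` per
      -- nonempty cube; each good type is shattered by at most `h * surface d k` cubes, as otherwise
      -- a chain of cubes gives a copy.
      contract : ¬ StrictCopy F → ∀ k → ∑ (upTo (k * b ^ r) ⋆ d) (𝟙 ∘ F?) ≤
        ∑ (upTo k ⋆ d) (𝟙 ∘ contracted?) * #bad n d + length (types r) ^ d * (h * surface d k)
      contract ¬copy k = begin
        ∑ (upTo (k * b ^ r) ⋆ d) (𝟙 ∘ F?)
          ≡⟨ ∑-glue b r k d (𝟙 ∘ F?) ⟩
        ∑ us (λ u → ∑ (words b r ⋆ d) (𝟙 ∘ block? u))
          ≤⟨ ∑-mono us (λ u → #≤#shattered b≤g⁻+μ hit (block? u)) ⟩
        ∑ us (λ u → ∑ Ts (𝟙 ∘ shatters? (block? u)))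
          ≤⟨ ∑-mono us (λ u → ∑-mono Ts (split u)) ⟩
        ∑ us (λ u → ∑ Ts (λ T → 𝟙 (contracted? u) * 𝟙 (bad? n T) + x u T))
          ≡⟨ ∑-cong us (λ u → trans (∑-+ Ts (λ T → 𝟙 (contracted? u) * 𝟙 (bad? n T)) (x u))
                                    (cong (_+ ∑ Ts (x u)) (∑-*ˡ (𝟙 (contracted? u)) Ts (𝟙 ∘ bad? n)))) ⟩
        ∑ us (λ u → 𝟙 (contracted? u) * #bad n d + ∑ Ts (x u))
          ≡⟨ trans (∑-+ us (λ u → 𝟙 (contracted? u) * #bad n d) (λ u → ∑ Ts (x u)))
                   (cong₂ _+_ (∑-*ʳ (#bad n d) us (𝟙 ∘ contracted?)) (∑-swap us Ts x)) ⟩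
        ∑ us (𝟙 ∘ contracted?) * #bad n d + ∑ Ts (λ T → ∑ us (λ u → x u T))
          ≡⟨ cong (∑ us (𝟙 ∘ contracted?) * #bad n d +_) (∑-cong Ts λ T → ∑-*ˡ (𝟙 (good? n T)) us _) ⟩
        ∑ us (𝟙 ∘ contracted?) * #bad n d + ∑ Ts (λ T → 𝟙 (good? n T) * ∑ us (λ u → 𝟙 (shatters? (block? u) T)))
          ≤⟨ +-monoʳ-≤ (∑ us (𝟙 ∘ contracted?) * #bad n d) (∑-≤const Ts (good-≤ ¬copy k)) ⟩
        ∑ us (𝟙 ∘ contracted?) * #bad n d + length Ts * (h * surface d k)
          ≡⟨ cong (λ l → ∑ us (𝟙 ∘ contracted?) * #bad n d + l * (h * surface d k)) (length-⋆ (types r) d) ⟩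
        ∑ us (𝟙 ∘ contracted?) * #bad n d + length (types r) ^ d * (h * surface d k) ∎
        where
        open ≤-Reasoning
        us = upTo k ⋆ d
        Ts = types r ⋆ d
        x : Vec ℕ d → Vec (Type r) d → ℕ
        x u T = 𝟙 (good? n T) * 𝟙 (shatters? (block? u) T)

  -- Recursion over the side length

  module _ (g⁻ b μ : ℕ) (E : List (Vec (Fin b) (suc g⁻))) (r : ℕ) (2h≡g : h + h ≡ suc g⁻)
    (g≤b : suc g⁻ ≤ b) (b≤g⁻+μ : b ≤ g⁻ + μ)
    (hit : ∀ {Y : Pred (Fin b) 0ℓ} (Y? : Decidable Y) → suc g⁻ ≤ #Fin Y? → 1 ≤ ∑ E (𝟙 ∘ hits? Y?))
    (1≤M : 1 ≤ length E * μ) (1<S : 1 < b ^ r) {d} (n≤d : n ≤ d) where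
    open Types g⁻ b μ E
    open Shattering g⁻ b μ E r

    -- `X` is the cost of one recursion step relative to `k ^ d`: the first summand comes from
    -- cutting `k` down to a multiple of `S`, the second from the good types.
    S X : ℕ
    S = b ^ r
    X = suc d * S + M ^ suc d * S * (h * suc d)

    instance
      S≢0 : NonZero S
      S≢0 = >-nonZero (<-trans (s≤s z≤n) 1<S)

    scaled : ∀ k → k / S * S ≤ k → (k / S) ^ d * S ^ d ≤ k ^ d
    scaled k k′S≤k = ≤-trans (≤-reflexive (sym (^-distribʳ-* d (k / S) S))) (^-monoˡ-≤ d k′S≤k)

    -- Induction on `k` with fuel `f`. As the bad types number at most half of `S ^ d`, the call for
    -- `k / S` accounts for at most half of `2 * X * k ^ d`; the cost `X * k ^ d` of the step is the
    -- other half.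
    size-≤ : 2 * #bad n (suc d) ≤ S ^ d → ∀ f k → k ≤ f → ∀ {F : Pred (Vec ℕ (suc d)) 0ℓ} (F? : Decidable F) →
      ¬ StrictCopy F → ∑ (upTo k ⋆ suc d) (𝟙 ∘ F?) ≤ 2 * X * k ^ d
    size-≤ thin f       zero    k≤f       F? ¬copy = z≤n
    size-≤ thin (suc f) (suc k) (s≤s k≤f) {F} F? ¬copy = *-cancelˡ-≤ 2 (begin
      2 * ∑ (upTo K ⋆ suc d) (𝟙 ∘ F?)
        ≤⟨ *-monoʳ-≤ 2 (∑-trim (All-replicate (trims-upTo k′S≤K K≤)) (𝟙 ∘ F?) 1 (𝟙≤1 ∘ F?)) ⟩
      2 * (∑ (pi (Vec.replicate (suc d) (upTo (k′ * S)))) (𝟙 ∘ F?) + S * 1 * surface (suc d) K)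
        ≤⟨ *-monoʳ-≤ 2 (+-monoˡ-≤ _ (contract g⁻ b μ E r 2h≡g (s≤s n≤d) F? b≤g⁻+μ hit ¬copy k′)) ⟩
      2 * (#F′ * #bad n (suc d) + length (types r) ^ suc d * (h * surface (suc d) k′) + S * 1 * surface (suc d) K)
        ≡⟨ cong₂ (λ x y → 2 * (#F′ * #bad n (suc d) + length (types r) ^ suc d * (h * x) + S * 1 * y))
                 (surface-suc d k′) (surface-suc d K) ⟩
      2 * (#F′ * #bad n (suc d) + length (types r) ^ suc d * (h * (suc d * k′ ^ d)) + S * 1 * (suc d * K ^ d))
        -- The contracted set has no strict copy, since gluing would lift it to `F`; so the
        -- induction hypothesis applies.
        ≤⟨ *-monoʳ-≤ 2 (+-monoˡ-≤ _ (+-mono-≤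
             (*-monoˡ-≤ (#bad n (suc d)) (size-≤ thin f k′ k′≤f (contracted? g⁻ b μ E r 2h≡g (s≤s n≤d) F?) (¬copy ∘ strictCopy-glue {b} {r} {F = F})))
             (*-monoˡ-≤ _ (^-monoˡ-≤ (suc d) (length-types-≤ 1≤M g≤b))))) ⟩
      2 * (2 * X * k′ ^ d * #bad n (suc d) + (M * S) ^ suc d * (h * (suc d * k′ ^ d)) + S * 1 * (suc d * K ^ d))
        ≡⟨ cong (λ x → 2 * (2 * X * k′ ^ d * #bad n (suc d) + x * (h * (suc d * k′ ^ d)) + S * 1 * (suc d * K ^ d)))
                (^-distribʳ-* (suc d) M S) ⟩
      2 * (2 * X * k′ ^ d * #bad n (suc d) + M ^ suc d * S ^ suc d * (h * (suc d * k′ ^ d)) + S * 1 * (suc d * K ^ d))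
        ≡⟨ lemma₁ X (k′ ^ d) (#bad n (suc d)) (M ^ suc d) S (S ^ d) h (suc d) (K ^ d) ⟩
      2 * X * (k′ ^ d * (2 * #bad n (suc d))) + 2 * (M ^ suc d * S * (h * suc d) * (k′ ^ d * S ^ d)) + 2 * (suc d * S * K ^ d)
        ≤⟨ +-monoˡ-≤ _ (+-mono-≤ (*-monoʳ-≤ (2 * X) (≤-trans (*-monoʳ-≤ (k′ ^ d) thin) (scaled K k′S≤K)))
                                 (*-monoʳ-≤ 2 (*-monoʳ-≤ (M ^ suc d * S * (h * suc d)) (scaled K k′S≤K)))) ⟩
      2 * X * K ^ d + 2 * (M ^ suc d * S * (h * suc d) * K ^ d) + 2 * (suc d * S * K ^ d)
        ≡⟨ lemma₂ (suc d * S) (M ^ suc d * S * (h * suc d)) (K ^ d) ⟩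
      2 * (2 * X * K ^ d) ∎)
      where
      open ≤-Reasoning
      K k′ #F′ : ℕ
      K  = suc k
      k′ = K / S
      #F′ = ∑ (upTo k′ ⋆ suc d) (𝟙 ∘ contracted? g⁻ b μ E r 2h≡g (s≤s n≤d) F?)

      k′S≤K : k′ * S ≤ K
      k′S≤K = m/n*n≤m K S

      K≤ : K ≤ k′ * S + S
      K≤ = ≤-trans (≤-reflexive (trans (m≡m%n+[m/n]*n K S) (+-comm (K % S) _))) (+-monoʳ-≤ (k′ * S) (<⇒≤ (m%n<n K S)))

      k′≤f : k′ ≤ f
      k′≤f = ≤-trans (≤-pred (m/n<m K S 1<S)) k≤f

      lemma₁ : ∀ X p t m s q h d z → 2 * (2 * X * p * t + m * (s * q) * (h * (d * p)) + s * 1 * (d * z)) ≡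
        2 * X * (p * (2 * t)) + 2 * (m * s * (h * d) * (p * q)) + 2 * (d * s * z)
      lemma₁ = solve-∀
      lemma₂ : ∀ x y z → 2 * (x + y) * z + 2 * (y * z) + 2 * (x * z) ≡ 2 * (2 * (x + y) * z)
      lemma₂ = solve-∀

    -- As in Markov's inequality: every bad vector weighs at least `α ^ e`, and the total weight is
    -- at most `(2 * (M * S)) ^ suc d`.
    thin : ∀ α e → 1 ≤ α → e + n ≤ suc (suc d) → α * g⁻ ^ r ≤ M * S → 2 * (2 * (M * S)) ^ suc d ≤ α ^ e * S ^ d →
      2 * #bad n (suc d) ≤ S ^ d
    thin α@(suc _) e 1≤α e+n≤ α≤ big = *-cancelˡ-≤ (α ^ e) {{m^n≢0 α e}} (begin
      α ^ e * (2 * #bad n (suc d))      ≡⟨ lemma (α ^ e) (#bad n (suc d)) ⟩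
      2 * (#bad n (suc d) * α ^ e)      ≤⟨ *-monoʳ-≤ 2 (≤-trans (#bad-weight α n (suc d) e e+n≤)
                                             (^-monoˡ-≤ (suc d) (∑-weight α g≤b α≤))) ⟩
      2 * (2 * (M * S)) ^ suc d         ≤⟨ big ⟩
      α ^ e * S ^ d                     ∎)
      where
      open ≤-Reasoning
      lemma : ∀ x y → x * (2 * y) ≡ 2 * (y * x)
      lemma = solve-∀

-- Choice of the constants

-- Membership in the form that counting uses.
Occurs : ∀ {A : Set} → A → List A → Set
Occurs x xs = ∀ f → f x ≤ ∑ xs f

occurs-allFin : ∀ {n} (i : Fin n) → Occurs i (allFin n)
occurs-allFin {suc n} i f = ≤-trans (step i) (≤-reflexive (sym (∑-allFin-suc n f)))
  where
  step : ∀ i → f i ≤ f zero + ∑ (allFin n) (f ∘ suc)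
  step zero    = m≤m+n _ _
  step (suc i) = ≤-trans (occurs-allFin i (f ∘ suc)) (m≤n+m _ _)

occurs-upTo : ∀ {n} (i : Fin n) → Occurs (toℕ i) (upTo n)
occurs-upTo {n} i f = ≤-trans (occurs-allFin i (f ∘ toℕ)) (≤-reflexive (∑-allFin n f))

occurs-⋆ : ∀ {A : Set} {xs : List A} {d} (v : Vec A d) → (∀ c → Occurs (lookup v c) xs) → Occurs v (xs ⋆ d)
occurs-⋆ []      occ f = m≤m+n _ _
occurs-⋆ {xs = xs} {suc d} (x ∷ v) occ f = ≤-trans (occurs-⋆ v (occ ∘ suc) (λ u → f (x ∷ u)))
  (≤-trans (occ zero (λ x → ∑ (xs ⋆ d) (λ u → f (x ∷ u)))) (≤-reflexive (sym (∑-pi xs (Vec.replicate d xs) f))))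

hit-allFin : ∀ g {Y : Pred (Fin g) 0ℓ} (Y? : Decidable Y) → g ≤ #Fin Y? →
  1 ≤ ∑ (Vec.allFin g ∷ []) (𝟙 ∘ hits? Y?)
hit-allFin g {Y} Y? g≤ = ≤-trans (≤-reflexive (sym (𝟙-yes (inc , hit) (hits? Y? (Vec.allFin g))))) (m≤m+n _ 0)
  where
  inc : Increasing (Vec.allFin g)
  inc i j i<j = subst₂ Fin._<_ (sym (Vec.lookup-allFin i)) (sym (Vec.lookup-allFin j)) i<j
  hit : ∀ i → Y (lookup (Vec.allFin g) i)
  hit i = #Fin-all Y? g≤ _

hit-⋆ : ∀ g b {Y : Pred (Fin b) 0ℓ} (Y? : Decidable Y) → g ≤ #Fin Y? →
  1 ≤ ∑ (allFin b ⋆ g) (𝟙 ∘ hits? Y?)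
hit-⋆ g b Y? g≤ =
  let e , e-hits = #Fin-select g Y? g≤
  in ≤-trans (≤-reflexive (sym (𝟙-yes e-hits (hits? Y? e))))
             (occurs-⋆ e (occurs-allFin ∘ lookup e) (𝟙 ∘ hits? Y?))

m<m^ : ∀ {b} → 2 ≤ b → ∀ m → m < b ^ m
m<m^ 2≤b zero    = s≤s z≤n
m<m^ {b} 2≤b (suc m) = begin-strict
  suc m            ≤⟨ m<m^ 2≤b m ⟩
  b ^ m            <⟨ m<m*n (b ^ m) b {{>-nonZero (≤-trans (s≤s z≤n) (m<m^ 2≤b m))}} 2≤b ⟩
  b ^ m * b        ≡⟨ *-comm (b ^ m) b ⟩
  b * b ^ m        ∎
  where open ≤-Reasoning

-- Bernoulli's inequality for `(1 + 1 / a) ^ m` with denominators cleared.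
bernoulli : ∀ a m → a ^ m * (a + m) ≤ suc a ^ m * a
bernoulli a zero    = ≤-reflexive (cong (_+ 0) (+-identityʳ a))
bernoulli a (suc m) = begin
  a * a ^ m * (a + suc m)                ≤⟨ m≤m+n _ (a ^ m * m) ⟩
  a * a ^ m * (a + suc m) + a ^ m * m    ≡⟨ lemma a m (a ^ m) ⟩
  suc a * (a ^ m * (a + m))              ≤⟨ *-monoʳ-≤ (suc a) (bernoulli a m) ⟩
  suc a * (suc a ^ m * a)                ≡⟨ *-assoc (suc a) (suc a ^ m) a ⟨
  suc a * suc a ^ m * a                  ∎
  where
  open ≤-Reasoning
  lemma : ∀ a m p → a * p * (a + suc m) + p * m ≡ suc a * (p * (a + m))
  lemma = solve-∀

2*a^a≤ : ∀ a .{{_ : NonZero a}} → 2 * a ^ a ≤ suc a ^ a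
2*a^a≤ a = *-cancelʳ-≤ (2 * a ^ a) (suc a ^ a) a
  (≤-trans (≤-reflexive (lemma a (a ^ a))) (bernoulli a a))
  where
  lemma : ∀ a p → 2 * p * a ≡ p * (a + a)
  lemma = solve-∀

16*a^4a≤ : ∀ a .{{_ : NonZero a}} → 16 * a ^ (a * 4) ≤ suc a ^ (a * 4)
16*a^4a≤ a = begin
  16 * a ^ (a * 4)     ≡⟨ cong (16 *_) (^-*-assoc a a 4) ⟨
  2 ^ 4 * (a ^ a) ^ 4  ≡⟨ ^-distribʳ-* 4 2 (a ^ a) ⟨
  (2 * a ^ a) ^ 4      ≤⟨ ^-monoˡ-≤ 4 (2*a^a≤ a) ⟩
  (suc a ^ a) ^ 4      ≡⟨ ^-*-assoc (suc a) a 4 ⟩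
  suc a ^ (a * 4)      ∎
  where open ≤-Reasoning

-- For large n one can take all g = 2h digits at once (M = 1), so that the constant is linear in n;
-- the numeric condition fails for small n, where the dependence on n is irrelevant and M may be large.
module Constants (h′ : ℕ) where

  h g⁻ g : ℕ
  h  = suc h′
  g⁻ = h′ + suc h′
  g  = suc g⁻

  instance
    g⁻≢0 : NonZero g⁻
    g⁻≢0 = >-nonZero (≤-trans (s≤s z≤n) (m≤n+m (suc h′) h′))

  2≤g : 2 ≤ g
  2≤g = s≤s (≤-trans (s≤s z≤n) (m≤n+m (suc h′) h′))

  -- This `r₁` makes `(g / g⁻) ^ r₁` at least 16, which admits the weight 16 for weak types.
  r₁ S₁ : ℕ
  r₁ = g⁻ * 4
  S₁ = g ^ r₁

  -- Here `S₂ = y ^ 4` while `g⁻ ^ r₂ ≤ y`, which admits the weight `y ^ 3`; and `r₂` is chosen to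
  -- give `4 * M₂ ≤ y`.
  b₂ M₂ r₂ y S₂ : ℕ
  b₂ = g ^ 4
  M₂ = length (allFin b₂ ⋆ g) * b₂
  r₂ = 4 * M₂
  y  = g ^ r₂
  S₂ = b₂ ^ r₂

  -- The bound `2 * X` of the recursion in dimension `2 * n`.
  constant : ℕ → ℕ → ℕ → ℕ
  constant n M S = 2 * (2 * n * S + M ^ (2 * n) * S * (h * (2 * n)))

  -- The first summand serves `S₁ ≤ n`, where the constant is `n` times a fixed number; the second
  -- serves `n ≤ S₁`, where the constant is at most its value at `S₁`. A number `x` is absorbed by
  -- `n ^ x`, as `2 ≤ n`.
  exponent : ℕ
  exponent = suc (4 * S₁ * suc h) + constant S₁ M₂ S₂

  instance
    b₂≢0 : NonZero b₂
    b₂≢0 = m^n≢0 g 4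

  1≤M₂ : 1 ≤ M₂
  1≤M₂ = >-nonZero⁻¹ M₂ {{m*n≢0 (length (allFin b₂ ⋆ g)) b₂ {{subst NonZero (sym eq) (m^n≢0 b₂ g)}}}}
    where
    eq : length (allFin b₂ ⋆ g) ≡ b₂ ^ g
    eq = trans (length-⋆ (allFin b₂) g) (cong (_^ g) (length-tabulate {n = b₂} id))

  S₂≡y⁴ : S₂ ≡ y ^ 4
  S₂≡y⁴ = trans (^-*-assoc g 4 r₂) (trans (cong (g ^_) (*-comm 4 r₂)) (sym (^-*-assoc g r₂ 4)))

  4M₂≤y : 4 * M₂ ≤ y
  4M₂≤y = <⇒≤ (m<m^ 2≤g r₂)

  instance
    y≢0 : NonZero y
    y≢0 = m^n≢0 g r₂

  1<S₁ : 1 < S₁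
  1<S₁ = ≤-trans (*-mono-≤ {2} {16} {1} (s≤s (s≤s z≤n)) (>-nonZero⁻¹ (g⁻ ^ r₁) {{m^n≢0 g⁻ r₁}})) (16*a^4a≤ g⁻)

  1<S₂ : 1 < S₂
  1<S₂ = begin-strict
    1            <⟨ s≤s (s≤s z≤n) ⟩
    4 * 1        ≤⟨ *-monoʳ-≤ 4 1≤M₂ ⟩
    4 * M₂       ≤⟨ 4M₂≤y ⟩
    y            ≤⟨ m≤m*n y (y ^ 3) {{m^n≢0 y 3}} ⟩
    y ^ 4        ≡⟨ S₂≡y⁴ ⟨
    S₂           ∎
    where open ≤-Reasoning

  split-power : ∀ n d M S → suc d ≡ 2 * n → 2 * (2 * (M * S)) ^ suc d ≡ 2 * ((2 * M) ^ 2) ^ n * S * S ^ d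
  split-power n d M S eq = begin
    2 * (2 * (M * S)) ^ suc d                 ≡⟨ cong (λ x → 2 * x ^ suc d) (*-assoc 2 M S) ⟨
    2 * (2 * M * S) ^ suc d                   ≡⟨ cong (2 *_) (^-distribʳ-* (suc d) (2 * M) S) ⟩
    2 * ((2 * M) ^ suc d * (S * S ^ d))       ≡⟨ cong (λ x → 2 * (x * (S * S ^ d))) (trans (cong ((2 * M) ^_) eq) (sym (^-*-assoc (2 * M) 2 n))) ⟩
    2 * (((2 * M) ^ 2) ^ n * (S * S ^ d))     ≡⟨ lemma (((2 * M) ^ 2) ^ n) S (S ^ d) ⟩
    2 * ((2 * M) ^ 2) ^ n * S * S ^ d         ∎
    where
    open ≡-Reasoning
    lemma : ∀ x s p → 2 * (x * (s * p)) ≡ 2 * x * s * p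
    lemma = solve-∀

  -- Since `S₁ ≤ n ≤ 4 ^ n`, the left side is at most `2 * 16 ^ n`.
  big₁ : ∀ n → S₁ ≤ n → 2 * (2 ^ 2) ^ n * S₁ ≤ 16 ^ suc n
  big₁ n S₁≤n = begin
    2 * 4 ^ n * S₁           ≤⟨ *-monoʳ-≤ (2 * 4 ^ n) (≤-trans S₁≤n (<⇒≤ (m<m^ (s≤s (s≤s z≤n)) n))) ⟩
    2 * 4 ^ n * 4 ^ n        ≡⟨ *-assoc 2 (4 ^ n) (4 ^ n) ⟩
    2 * (4 ^ n * 4 ^ n)      ≡⟨ cong (2 *_) (^-distribʳ-* n 4 4) ⟨
    2 * 16 ^ n               ≤⟨ *-monoˡ-≤ (16 ^ n) (s≤s (s≤s (z≤n {14}))) ⟩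
    16 * 16 ^ n              ∎
    where open ≤-Reasoning

  -- With `2 * (2 * M₂) ^ 2 ≤ y ^ 2` and `S₂ = y ^ 4` it remains to compare the exponents
  -- `2 * n + 4` and `3 * suc n` of `y`.
  big₂ : ∀ n → 1 ≤ n → 2 * ((2 * M₂) ^ 2) ^ n * S₂ ≤ (y ^ 3) ^ suc n
  big₂ n 1≤n = begin
    2 * ((2 * M₂) ^ 2) ^ n * S₂          ≤⟨ *-monoˡ-≤ S₂ (*-monoˡ-≤ (((2 * M₂) ^ 2) ^ n) (^-monoʳ-≤ 2 1≤n)) ⟩
    2 ^ n * ((2 * M₂) ^ 2) ^ n * S₂      ≡⟨ cong₂ _*_ (sym (^-distribʳ-* n 2 ((2 * M₂) ^ 2))) S₂≡y⁴ ⟩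
    (2 * (2 * M₂) ^ 2) ^ n * y ^ 4       ≤⟨ *-monoˡ-≤ (y ^ 4) (^-monoˡ-≤ n square) ⟩
    (y ^ 2) ^ n * y ^ 4                  ≡⟨ cong (_* y ^ 4) (^-*-assoc y 2 n) ⟩
    y ^ (2 * n) * y ^ 4                  ≡⟨ ^-distribˡ-+-* y (2 * n) 4 ⟨
    y ^ (2 * n + 4)                      ≤⟨ ^-monoʳ-≤ y exp ⟩
    y ^ (3 * suc n)                      ≡⟨ ^-*-assoc y 3 (suc n) ⟨
    (y ^ 3) ^ suc n                      ∎
    where
    open ≤-Reasoning
    square : 2 * (2 * M₂) ^ 2 ≤ y ^ 2
    square = begin
      2 * (2 * M₂) ^ 2                   ≤⟨ *-monoˡ-≤ ((2 * M₂) ^ 2) (s≤s (s≤s (z≤n {2}))) ⟩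
      2 ^ 2 * (2 * M₂) ^ 2               ≡⟨ ^-distribʳ-* 2 2 (2 * M₂) ⟨
      (2 * (2 * M₂)) ^ 2                 ≡⟨ cong (_^ 2) (*-assoc 2 2 M₂) ⟨
      (4 * M₂) ^ 2                       ≤⟨ ^-monoˡ-≤ 2 4M₂≤y ⟩
      y ^ 2                              ∎
    exp : 2 * n + 4 ≤ 3 * suc n
    exp = begin
      2 * n + 4                          ≡⟨ lemma₁ n ⟩
      2 * n + 3 + 1                      ≤⟨ +-monoʳ-≤ (2 * n + 3) 1≤n ⟩
      2 * n + 3 + n                      ≡⟨ lemma₂ n ⟩
      3 * suc n                          ∎
      where
      lemma₁ : ∀ n → 2 * n + 4 ≡ 2 * n + 3 + 1
      lemma₁ = solve-∀
      lemma₂ : ∀ n → 2 * n + 3 + n ≡ 3 * suc n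
      lemma₂ = solve-∀

  exponent-large : ∀ n → 2 ≤ n → constant n 1 S₁ ≤ n ^ exponent
  exponent-large n 2≤n = begin
    2 * (2 * n * S₁ + 1 ^ (2 * n) * S₁ * (h * (2 * n)))   ≡⟨ cong (λ x → 2 * (2 * n * S₁ + x * S₁ * (h * (2 * n)))) (^-zeroˡ (2 * n)) ⟩
    2 * (2 * n * S₁ + 1 * S₁ * (h * (2 * n)))             ≡⟨ lemma n S₁ h ⟩
    n * (4 * S₁ * suc h)                                  ≤⟨ *-monoʳ-≤ n (<⇒≤ (m<m^ 2≤n (4 * S₁ * suc h))) ⟩
    n ^ suc (4 * S₁ * suc h)                              ≤⟨ ^-monoʳ-≤ n {{>-nonZero (≤-trans (s≤s z≤n) 2≤n)}} {suc (4 * S₁ * suc h)} {exponent} (m≤m+n (suc (4 * S₁ * suc h)) (constant S₁ M₂ S₂)) ⟩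
    n ^ exponent                                          ∎
    where
    open ≤-Reasoning
    lemma : ∀ n s h → 2 * (2 * n * s + 1 * s * (h * (2 * n))) ≡ n * (4 * s * suc h)
    lemma = solve-∀

  exponent-small : ∀ n → 2 ≤ n → n ≤ S₁ → constant n M₂ S₂ ≤ n ^ exponent
  exponent-small n 2≤n n≤S₁ = begin
    constant n M₂ S₂                        ≤⟨ *-monoʳ-≤ 2 (+-mono-≤ (*-monoˡ-≤ S₂ 2n≤)
                                                 (*-mono-≤ (*-monoˡ-≤ S₂ (^-monoʳ-≤ M₂ {{>-nonZero 1≤M₂}} 2n≤)) (*-monoʳ-≤ h 2n≤))) ⟩
    constant S₁ M₂ S₂                       ≤⟨ <⇒≤ (m<m^ 2≤n (constant S₁ M₂ S₂)) ⟩
    n ^ constant S₁ M₂ S₂                   ≤⟨ ^-monoʳ-≤ n {{>-nonZero (≤-trans (s≤s z≤n) 2≤n)}} (m≤n+m _ (suc (4 * S₁ * suc h))) ⟩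
    n ^ exponent                            ∎
    where
    open ≤-Reasoning
    2n≤ : 2 * n ≤ 2 * S₁
    2n≤ = *-monoʳ-≤ 2 n≤S₁

-- The bound for sets without strict copies

module Bound {n} {_⊑_ : Fin n → Fin n → Set} (_⊑?_ : ∀ p q → Dec (p ⊑ q))
  (⊑-refl : ∀ {p} → p ⊑ p) (⊑-trans : ∀ {p q r} → p ⊑ q → q ⊑ r → p ⊑ r)
  (h′ : ℕ) (ℓ : Fin n → ℕ) (ℓ< : ∀ p → ℓ p < suc h′) (ℓ-anti : ∀ {p q} → p ⊑ q → p ≢ q → ℓ q < ℓ p)
  (2≤n : 2 ≤ n) {d} (d+1≡2n : suc d ≡ 2 * n) where

  open Constants h′
  open Copies _⊑?_ ⊑-refl ⊑-trans h ℓ ℓ< ℓ-anti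

  n≤d : n ≤ d
  n≤d = ≤-pred (begin
    suc n        ≤⟨ +-monoˡ-≤ n (≤-trans (s≤s z≤n) 2≤n) ⟩
    n + n        ≡⟨ cong (n +_) (+-identityʳ n) ⟨
    2 * n        ≡⟨ d+1≡2n ⟨
    suc d        ∎)
    where open ≤-Reasoning

  -- Among `2 * n` coordinates, fewer than `n` strong ones leave at least `n + 1` weak ones; hence
  -- `e = suc n` in `thin`.
  suc-n+n≤ : suc n + n ≤ suc (suc d)
  suc-n+n≤ = ≤-reflexive (cong suc (trans (cong (n +_) (sym (+-identityʳ n))) (sym d+1≡2n)))

  module _ {F : Pred (Vec ℕ (suc d)) 0ℓ} (F? : Decidable F) (¬copy : ¬ StrictCopy F) (k : ℕ) where

    size-large : S₁ ≤ n → ∑ (upTo k ⋆ suc d) (𝟙 ∘ F?) ≤ constant n 1 S₁ * k ^ d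
    size-large S₁≤n = subst (λ x → ∑ (upTo k ⋆ suc d) (𝟙 ∘ F?) ≤ 2 * (x * S₁ + 1 ^ x * S₁ * (h * x)) * k ^ d) d+1≡2n
      (size-≤ g⁻ g 1 (Vec.allFin g ∷ []) r₁ refl ≤-refl (≤-reflexive (+-comm 1 g⁻)) (hit-allFin g) ≤-refl 1<S₁ n≤d
        (thin g⁻ g 1 (Vec.allFin g ∷ []) r₁ refl ≤-refl (≤-reflexive (+-comm 1 g⁻)) (hit-allFin g) ≤-refl 1<S₁ n≤d
          16 (suc n) (s≤s z≤n) suc-n+n≤ (≤-trans (16*a^4a≤ g⁻) (≤-reflexive (sym (*-identityˡ S₁))))
          (≤-trans (≤-reflexive (split-power n d 1 S₁ d+1≡2n)) (*-monoˡ-≤ (S₁ ^ d) (big₁ n S₁≤n))))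
        k k ≤-refl F? ¬copy)

    size-small : ∑ (upTo k ⋆ suc d) (𝟙 ∘ F?) ≤ constant n M₂ S₂ * k ^ d
    size-small = subst (λ x → ∑ (upTo k ⋆ suc d) (𝟙 ∘ F?) ≤ 2 * (x * S₂ + M₂ ^ x * S₂ * (h * x)) * k ^ d) d+1≡2n
      (size-≤ g⁻ b₂ b₂ (allFin b₂ ⋆ g) r₂ refl g≤b₂ (m≤n+m b₂ g⁻) (hit-⋆ g b₂) 1≤M₂ 1<S₂ n≤d
        (thin g⁻ b₂ b₂ (allFin b₂ ⋆ g) r₂ refl g≤b₂ (m≤n+m b₂ g⁻) (hit-⋆ g b₂) 1≤M₂ 1<S₂ n≤d
          (y ^ 3) (suc n) (>-nonZero⁻¹ (y ^ 3) {{m^n≢0 y 3}}) suc-n+n≤ α≤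
          (≤-trans (≤-reflexive (split-power n d M₂ S₂ d+1≡2n)) (*-monoˡ-≤ (S₂ ^ d) (big₂ n (≤-trans (s≤s z≤n) 2≤n)))))
        k k ≤-refl F? ¬copy)
      where
      open ≤-Reasoning
      g≤b₂ : g ≤ b₂
      g≤b₂ = m≤m*n g (g ^ 3) {{m^n≢0 g 3}}
      α≤ : y ^ 3 * g⁻ ^ r₂ ≤ M₂ * S₂
      α≤ = begin
        y ^ 3 * g⁻ ^ r₂      ≤⟨ *-monoʳ-≤ (y ^ 3) (^-monoˡ-≤ r₂ (n≤1+n g⁻)) ⟩
        y ^ 3 * y            ≡⟨ *-comm (y ^ 3) y ⟩
        y ^ 4                ≡⟨ S₂≡y⁴ ⟨
        S₂                   ≡⟨ *-identityˡ S₂ ⟨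
        1 * S₂               ≤⟨ *-monoˡ-≤ S₂ 1≤M₂ ⟩
        M₂ * S₂              ∎

    size : ∑ (upTo k ⋆ suc d) (𝟙 ∘ F?) ≤ n ^ exponent * k ^ d
    size with S₁ ≤? n
    ... | yes S₁≤n = ≤-trans (size-large S₁≤n) (*-monoˡ-≤ (k ^ d) (exponent-large n 2≤n))
    ... | no S₁≰n  = ≤-trans size-small (*-monoˡ-≤ (k ^ d) (exponent-small n 2≤n (<⇒≤ (≰⇒> S₁≰n))))

-- From the poset to its levels

-- Used to take the order of the poset as decidable while proving a stable statement.
¬¬-∀ : ∀ {n} {P : Pred (Fin n) 0ℓ} → (∀ i → ¬ ¬ P i) → ¬ ¬ (∀ i → P i)
¬¬-∀ {zero}  f ¬g = ¬g λ ()
¬¬-∀ {suc n} f ¬g = f zero λ p₀ → ¬¬-∀ (f ∘ suc) λ ps → ¬g (Fin.∀-cons p₀ ps)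

module Levels {n} (P : FinPoset n) (_⊑?_ : ∀ p q → Dec (_≤P_ P p q)) where
  open IsPartialOrder (isPartialOrder P) using (antisym) renaming (trans to ⊑-trans)

  _⊑_ _⊏_ : Fin n → Fin n → Set
  p ⊑ q = _≤P_ P p q
  p ⊏ q = p ⊑ q × p ≢ q

  ⊏-trans : ∀ {p q r} → p ⊏ q → q ⊏ r → p ⊏ r
  ⊏-trans (p⊑q , p≢q) (q⊑r , q≢r) =
    ⊑-trans p⊑q q⊑r , λ p≡r → q≢r (antisym q⊑r (subst (_⊑ _) p≡r p⊑q))

  -- The `t` elements of a strictly ascending chain lie above `p`. The level of `p` is the largest
  -- such `t`, so levels are counted from the top.
  Below : ℕ → Fin n → Set
  Below zero    p = ⊤
  Below (suc t) p = ∃ λ q → p ⊏ q × Below t q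

  below? : ∀ t → Decidable (Below t)
  below? zero    p = yes tt
  below? (suc t) p = Fin.any? λ q → ((p ⊑? q) ×-dec ¬? (p Fin.≟ q)) ×-dec below? t q

  below-pred : ∀ t {p} → Below (suc t) p → Below t p
  below-pred zero    _             = tt
  below-pred (suc t) (q , p⊏q , b) = q , p⊏q , below-pred t b

  below-≤ : ∀ {s t p} → s ≤ t → Below t p → Below s p
  below-≤ {t = zero}  z≤n b = b
  below-≤ {s} {suc t} s≤t b with m≤n⇒m<n∨m≡n s≤t
  ... | inj₁ s<t  = below-≤ (≤-pred s<t) (below-pred t b)
  ... | inj₂ refl = b

  ascending : ∀ t {p} → Below t p → ∃ λ xs → length xs ≡ t × All (p ⊏_) xs × AllPairs _⊏_ xs
  ascending zero    _             = [] , refl , [] , []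
  ascending (suc t) (q , p⊏q , b) with xs , len , q⊏ , asc ← ascending t b =
    q ∷ xs , cong suc len , p⊏q ∷ All.map (⊏-trans p⊏q) q⊏ , q⊏ ∷ asc

  below⇒chain : ∀ t {p} → Below t p → ∃ λ xs → IsChain P xs × length xs ≡ suc t
  below⇒chain t {p} b with xs , len , p⊏ , asc ← ascending t b =
    p ∷ xs , (AllPairs.map proj₂ (p⊏ ∷ asc) , AllPairs.map (inj₁ ∘ proj₁) (p⊏ ∷ asc)) , cong suc len

  module _ {h} (chains≤ : ∀ xs → IsChain P xs → length xs ≤ h) where

    ¬below : ∀ p → ¬ Below h p
    ¬below p b with xs , ch , len ← below⇒chain h b = <-irrefl refl (subst (_≤ h) len (chains≤ xs ch))

    search : ∀ t p → ¬ Below t p → ∃ λ m → m < t × Below m p × ¬ Below (suc m) p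
    search zero    p ¬b = ⊥-elim (¬b tt)
    search (suc t) p ¬b with below? t p
    ... | yes b  = t , ≤-refl , b , ¬b
    ... | no ¬b′ with m , m<t , rest ← search t p ¬b′ = m , m≤n⇒m≤1+n m<t , rest

    level : Fin n → ℕ
    level p = proj₁ (search h p (¬below p))

    level< : ∀ p → level p < h
    level< p = proj₁ (proj₂ (search h p (¬below p)))

    level-anti : ∀ {p q} → p ⊑ q → p ≢ q → level q < level p
    level-anti {p} {q} p⊑q p≢q with level q <? level p
    ... | yes lt = lt
    -- Otherwise `p` in front of a longest chain above `q` would exceed the level of `p`.
    ... | no ≮   = ⊥-elim (proj₂ (proj₂ (proj₂ (search h p (¬below p))))
      (below-≤ (s≤s (≮⇒≥ ≮)) (q , (p⊑q , p≢q) , proj₁ (proj₂ (proj₂ (search h q (¬below q)))))))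

-- Families of grid points as sets of integer vectors

pointwise⁺ : ∀ {k d} {u v : Grid k d} → (∀ c → toℕ (lookup u c) ≤ toℕ (lookup v c)) → u ≤G v
pointwise⁺ {u = []}    {[]}    _  = []
pointwise⁺ {u = _ ∷ _} {_ ∷ _} u≤v = u≤v zero ∷ pointwise⁺ (u≤v ∘ suc)

coords : ∀ {k d} → Grid k d → Vec ℕ d
coords = Vec.map toℕ

coords-injective : ∀ {k d} {u v : Grid k d} → coords u ≡ coords v → u ≡ v
coords-injective {u = []}    {[]}    _  = refl
coords-injective {u = _ ∷ _} {_ ∷ _} eq =
  cong₂ _∷_ (Fin.toℕ-injective (Vec.∷-injectiveˡ eq)) (coords-injective (Vec.∷-injectiveʳ eq))

module _ {d : ℕ} where
  open DecMembership (Vec.≡-dec {n = d} _≟_) public using (_∈?_)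

-- Distinct entries have disjoint indicators, whose sum stays below the indicator of membership.
length≤∑ : ∀ {d} (ys : List (Vec ℕ d)) xs → Unique xs → All (λ x → Occurs x ys) xs →
  length xs ≤ ∑ ys (λ y → 𝟙 (y ∈? xs))
length≤∑ ys []       _             _            = z≤n
length≤∑ ys (x ∷ xs) (x∉ ∷ unique) (occ ∷ occs) = begin
  1 + length xs
    ≤⟨ +-mono-≤ (≤-trans (≤-reflexive (sym (𝟙-yes refl (Vec.≡-dec _≟_ x x)))) (occ (λ y → 𝟙 (Vec.≡-dec _≟_ y x))))
                (length≤∑ ys xs unique occs) ⟩
  ∑ ys (λ y → 𝟙 (Vec.≡-dec _≟_ y x)) + ∑ ys (λ y → 𝟙 (y ∈? xs))
    ≡⟨ ∑-+ ys _ _ ⟨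
  ∑ ys (λ y → 𝟙 (Vec.≡-dec _≟_ y x) + 𝟙 (y ∈? xs))
    ≤⟨ ∑-mono ys (λ y → disjoint (Vec.≡-dec _≟_ y x) (y ∈? xs) (y ∈? (x ∷ xs))) ⟩
  ∑ ys (λ y → 𝟙 (y ∈? (x ∷ xs))) ∎
  where
  open ≤-Reasoning
  disjoint : ∀ {y} (p : Dec (y ≡ x)) (q : Dec (y ∈ xs)) (r : Dec (y ∈ x ∷ xs)) → 𝟙 p + 𝟙 q ≤ 𝟙 r
  disjoint (yes refl) (yes y∈) _ = ⊥-elim (All.lookup x∉ y∈ refl)
  disjoint (yes eq)   (no _)   r = ≤-reflexive (sym (𝟙-yes (here eq) r))
  disjoint (no _)     (yes y∈) r = ≤-reflexive (sym (𝟙-yes (there y∈) r))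
  disjoint (no _)     (no _)   r = z≤n

occurs-coords : ∀ {k d} (u : Grid k d) → Occurs (coords u) (upTo k ⋆ d)
occurs-coords {k} u = occurs-⋆ (coords u) λ c →
  subst (λ x → Occurs x (upTo k)) (sym (Vec.lookup-map c toℕ u)) (occurs-upTo (lookup u c))

length≤∑-coords : ∀ {k d} (F : List (Grid k d)) → Unique F →
  length F ≤ ∑ (upTo k ⋆ d) (λ u → 𝟙 (u ∈? map coords F))
length≤∑-coords {k} {d} F unique = ≤-trans (≤-reflexive (sym (length-map coords F)))
  (length≤∑ (upTo k ⋆ d) (map coords F) (map⁺ coords-injective unique) (occurs F))
  where
  occurs : ∀ F → All (λ x → Occurs x (upTo k ⋆ d)) (map coords F)
  occurs []      = []
  occurs (u ∷ F) = occurs-coords u ∷ occurs F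

module _ {n} (P : FinPoset n) where

  bound-decidable : ∀ h′ → HasHeight P (suc h′) → 2 ≤ n → ∀ d → suc d ≡ 2 * n →
    (∀ p q → Dec (_≤P_ P p q)) → ∀ k (F : List (Grid k (suc d))) → Unique F → ¬ InducedCopy P F →
    length F ≤ n ^ Constants.exponent h′ * k ^ d
  bound-decidable h′ height 2≤n d eq _⊑?_ k F unique ¬copy =
    ≤-trans (length≤∑-coords F unique) (size (_∈? map coords F) (¬copy ∘ induced) k)
    where
    open IsPartialOrder (isPartialOrder P) using () renaming (refl to ⊑-refl; trans to ⊑-trans)
    open Levels P _⊑?_
    open Copies _⊑?_ ⊑-refl ⊑-trans (suc h′) (level (proj₂ height)) (level< (proj₂ height)) (level-anti (proj₂ height))
    open Bound _⊑?_ ⊑-refl ⊑-trans h′ (level (proj₂ height)) (level< (proj₂ height)) (level-anti (proj₂ height)) 2≤n eq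

    -- Strict increase preserves the order, separation reflects it, and reflection with antisymmetry
    -- gives injectivity.
    induced : StrictCopy (_∈ map coords F) → InducedCopy P F
    induced (π , π∈ , up , sep) = ρ , (λ p → proj₁ (proj₂ (∈-map⁻ coords (π∈ p)))) , injective ,
      λ p q → mk⇔ (to p q) (from p q)
      where
      ρ : Fin n → Grid k (suc d)
      ρ p = proj₁ (∈-map⁻ coords (π∈ p))

      lookup-ρ : ∀ p c → lookup (π p) c ≡ toℕ (lookup (ρ p) c)
      lookup-ρ p c = trans (cong (λ v → lookup v c) (proj₂ (proj₂ (∈-map⁻ coords (π∈ p))))) (Vec.lookup-map c toℕ (ρ p))

      to : ∀ p q → p ⊑ q → ρ p ≤G ρ q
      to p q p⊑q with p Fin.≟ q
      ... | yes refl = Pointwise.refl ≤-refl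
      ... | no p≢q   = pointwise⁺ λ c → subst₂ _≤_ (lookup-ρ p c) (lookup-ρ q c) (<⇒≤ (up p⊑q p≢q c))

      from : ∀ p q → ρ p ≤G ρ q → p ⊑ q
      from p q ρ≤ with p ⊑? q
      ... | yes p⊑q = p⊑q
      ... | no p⋢q with c , lt ← sep p⋢q =
        ⊥-elim (<⇒≱ (subst₂ _<_ (lookup-ρ q c) (lookup-ρ p c) lt) (Pointwise.lookup ρ≤ c))

      injective : ∀ {p q} → ρ p ≡ ρ q → p ≡ q
      injective {p} {q} eq = IsPartialOrder.antisym (isPartialOrder P)
        (from p q (subst (ρ p ≤G_) eq (Pointwise.refl ≤-refl)))
        (from q p (subst (_≤G ρ p) eq (Pointwise.refl ≤-refl)))

theorem9 : (h : ℕ) → 1 ≤ h → Σ ℕ λ c →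
    (n : ℕ) (P : FinPoset n) → HasHeight P h →
    (k : ℕ) → 1 ≤ k →
    (F : List (Grid k (2 * n))) → Unique F →
    ¬ InducedCopy P F →
    length F ≤ n ^ c * k ^ (2 * n ∸ 1)
theorem9 (suc h′) _ = Constants.exponent h′ , λ where
  zero          P ((() ∷ _ , _ , _) , _)  k 1≤k F unique ¬copy
  zero          P (([] , _ , ()) , _)     k 1≤k F unique ¬copy
  -- For `n = 1` the factor `n ^ c` is 1 whatever `c` is, so this case is settled directly: any
  -- member of the family is a copy.
  (suc zero)    P height k 1≤k []      unique ¬copy → z≤n
  (suc zero)    P height k 1≤k (u ∷ F) unique ¬copy → ⊥-elim (¬copy
    ( (λ _ → u) , (λ _ → here refl) , (λ { {zero} {zero} _ → refl })
    , λ { zero zero → mk⇔ (λ _ → Pointwise.refl ≤-refl) (λ _ → IsPartialOrder.refl (isPartialOrder P)) }))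
  -- The inequality is decidable, hence stable, so the finitely many order relations may be assumed
  -- decided.
  (suc (suc n)) P height k 1≤k F unique ¬copy → decidable-stable (_ ≤? _) λ ¬≤ →
    ¬¬-∀ (λ p → ¬¬-∀ (λ q → ¬¬-excluded-middle)) λ ⊑? →
    ¬≤ (bound-decidable P h′ height (s≤s (s≤s z≤n)) _ refl ⊑? k F unique ¬copy)
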